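{- Let $T$ be a tree of order at least $3$. If $\Delta(T)$ is odd and $T$ is not $(3^p-2)$-regular for any integer $p\geq 2$, then $\chi'_g(T)\leq\Delta(T)+2$; otherwise $\chi'_g(T)\leq\Delta(T)+3$.
   Context: For an integer $r\geq 2$, a tree is $r$-regular if each of its non-leaf vertices has degree $r$. For an Abelian group $\mathcal{G}$ (written additively), a $\mathcal{G}$-twin edge coloring of a graph $G$ is a proper edge labeling $f:E(G)\to\mathcal{G}$ (adjacent edges receive distinct labels) such that the weighted degrees $w(v)=\sum_{u\in N(v)}f(uv)$ satisfy $w(u)\neq w(v)$ for every edge $uv$. The group twin chromatic index $\chi'_g(G)$ is the least integer $k\geq 2$ such that $G$ has a $\mathcal{G}$-twin edge coloring for every Abelian group $\mathcal{G}$ of order $k$. $\Delta(T)$ is the maximum degree. -}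

module Defs where

open import Level using (Level) renaming (_⊔_ to _⊔ˡ_)
open import Data.Nat using (ℕ; zero; suc; _+_; _∸_; _<_; _≤_; _⊔_)
open import Data.Fin using (Fin)
open Fin
open import Data.Bool using (Bool; true; false; if_then_else_)
open import Data.Product using (Σ; ∃; _×_; _,_)
open import Data.Empty using (⊥)
open import Relation.Nullary using (¬_)
open import Relation.Binary.PropositionalEquality using (_≡_; _≢_)
import Relation.Binary.PropositionalEquality as ≡
open import Algebra.Bundles using (AbelianGroup)
open import Function.Bundles using (Bijection)

record SimpleGraph (n : ℕ) : Set where
  field
    adj    : Fin n → Fin n → Bool
    sym    : ∀ u v → adj u v ≡ adj v u
    irrefl : ∀ v → adj v v ≡ false
open SimpleGraph public

module _ {n : ℕ} (G : SimpleGraph n) where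

  Adj : Fin n → Fin n → Set
  Adj u v = adj G u v ≡ true

  data Walk : Fin n → Fin n → Set where
    here : ∀ {v} → Walk v v
    step : ∀ {u w v} → Adj u w → Walk w v → Walk u v

  Connected : Set
  Connected = ∀ u v → Walk u v

  HasCycle : Set
  HasCycle = Σ ℕ λ m → (3 ≤ m) × (Σ (ℕ → Fin n) λ c →
               (∀ i j → i < m → j < m → c i ≡ c j → i ≡ j)
             × (∀ i → suc i < m → Adj (c i) (c (suc i)))
             × Adj (c (m ∸ 1)) (c 0))

  IsTree : Set
  IsTree = Connected × ¬ HasCycle

sumℕ : (m : ℕ) → (Fin m → ℕ) → ℕ
sumℕ zero    f = 0
sumℕ (suc m) f = f zero + sumℕ m (λ i → f (suc i))

maxℕ : (m : ℕ) → (Fin m → ℕ) → ℕ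
maxℕ zero    f = 0
maxℕ (suc m) f = f zero ⊔ maxℕ m (λ i → f (suc i))

module _ {n : ℕ} (G : SimpleGraph n) where

  deg : Fin n → ℕ
  deg v = sumℕ n (λ u → if adj G v u then 1 else 0)

  Δ : ℕ
  Δ = maxℕ n deg

  IsRegularTree : ℕ → Set
  IsRegularTree r = ∀ v → deg v ≢ 1 → deg v ≡ r

module _ {c ℓ : Level} (A : AbelianGroup c ℓ) where
  open AbelianGroup A renaming (Carrier to C)

  gsum : (m : ℕ) → (Fin m → C) → C
  gsum zero    f = ε
  gsum (suc m) f = f zero ∙ gsum m (λ i → f (suc i))

  HasOrder : ℕ → Set (c ⊔ˡ ℓ)
  HasOrder k = Bijection setoid (≡.setoid (Fin k))

  module _ {n : ℕ} (G : SimpleGraph n) where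

    weight : (Fin n → Fin n → C) → Fin n → C
    weight f v = gsum n (λ u → if adj G v u then f v u else ε)

    IsTwinColoring : (Fin n → Fin n → C) → Set (ℓ)
    IsTwinColoring f =
        (∀ u v → Adj G u v → f u v ≈ f v u)
      × (∀ u v w → Adj G u v → Adj G u w → v ≢ w → ¬ (f u v ≈ f u w))
      × (∀ u v → Adj G u v → ¬ (weight f u ≈ weight f v))

    HasTwinColoring : Set (c ⊔ˡ ℓ)
    HasTwinColoring = Σ (Fin n → Fin n → C) IsTwinColoring

AllGroupsTwin : (c ℓ : Level) {n : ℕ} → SimpleGraph n → ℕ → Set (Level.suc (c ⊔ˡ ℓ))
AllGroupsTwin c ℓ G k = (A : AbelianGroup c ℓ) → HasOrder A k → HasTwinColoring A G

-- χ'_g(G) ≤ b : the least k ≥ 2 with AllGroupsTwin is ≤ b, i.e. some such k ≤ b exists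
GroupTwinIndex≤ : (c ℓ : Level) {n : ℕ} → SimpleGraph n → ℕ → Set (Level.suc (c ⊔ˡ ℓ))
GroupTwinIndex≤ c ℓ G b = Σ ℕ λ k → (2 ≤ k) × (k ≤ b) × AllGroupsTwin c ℓ G k

{-# OPTIONS --safe #-}

-- Root the tree and label the edges from the root downwards, using the neutral element at most on
-- an edge at a leaf.  If a non-root inner vertex v has parent edge labelled a and m ≥ 2 children,
-- label the child edges by a zero-sum m-set that avoids 0 and a: then w(v) = a, which differs from
-- the child labels and, inductively, from the weight of the parent.  (For m = 1 three forbidden
-- values leave a choice.)  A leaf has weight a as well.
--
-- In a group of odd order k zero-sum sets of every size 2 ≤ m ≤ k - 3 come from inverse pairs,
-- together with one triple {-a, -y, a + y} when m is odd.  This settles Δ even with k = Δ + 3, and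
-- Δ odd with k = Δ + 2 if the root can be given degree below Δ.  If T is regular and k = Δ + 2, the
-- root is a neighbour of a leaf and receives all labels except b and -2b, with total b; this needs
-- 3b ≠ 0, and such a b exists unless k is a power of 3.  In the remaining case Δ + 2 = 3^p, and
-- with k = 3^p + 1 all label sets are complements of sets of size 3 or 4 whose sum is that of
-- the whole group; they exist unless the group has exponent 2, which is impossible since
-- 3^p + 1 is not divisible by 8.
module Submission where

open import Defs hiding (sym)
open import Level using (Level; 0ℓ)
open import Function using (_∘_)
open import Function.Bundles using (Bijection)
open import Data.Bool using (true; false; if_then_else_)
import Data.Bool.Properties as Bool
open import Data.Nat using (ℕ; zero; suc; _+_; _*_; _∸_; _≤_; _<_; _^_; _%_; _/_; z≤n; s≤s; NonZero; nonTrivial⇒n>1)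
import Data.Nat.Properties as ℕ
open import Data.Nat.DivMod using (m%n<n; m≡m%n+[m/n]*n; %-distribˡ-+; [m+kn]%n≡m%n; m*n%n≡0)
open import Data.Nat.GCD using (module Bézout)
open import Data.Nat.Coprimality using (coprime-Bézout; prime⇒coprime)
open import Data.Nat.Primality using (Prime; prime[2]; prime?; prime⇒nonZero; prime⇒nonTrivial)
open import Data.Nat.Tactic.RingSolver using (solve-∀)
open import Data.Fin using (Fin)
import Data.Fin.Properties as Fin
open import Data.Product using (Σ; ∃; ∃₂; _×_; _,_; proj₁; proj₂)
open import Data.Sum using (_⊎_; inj₁; inj₂; [_,_]′)
open import Data.List using (List; []; _∷_; _++_; length; map; foldr; filter; allFin; tabulate)
open import Data.List.Extrema ℕ.≤-totalOrder using (argmax; f[xs]≤f[argmax])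
open import Data.List.Properties using (length-++; length-map; length-tabulate; ++-assoc; ++-identityʳ; filter-all; filter-reject)
open import Data.List.Membership.Propositional using (_∈_; _∉_)
open import Data.List.Membership.Propositional.Properties using (∈-∃++; ∈-++⁻; ∈-++⁺ˡ; ∈-++⁺ʳ; ∈-map⁺; ∈-map⁻; ∈-allFin; ∈-filter⁺; ∈-filter⁻)
open import Data.List.Membership.DecPropositional using (_∈?_)
open import Data.List.Membership.Setoid.Properties using (index-injective)
open import Data.List.Relation.Unary.Any using (here; there; index)
open import Data.List.Relation.Unary.All as All using (All; []; _∷_)
open import Data.List.Relation.Unary.All.Properties as AllProperties using (¬Any⇒All¬; All¬⇒¬Any)
open import Data.List.Relation.Unary.AllPairs using ([]; _∷_)
open import Data.List.Relation.Unary.Linked using (Linked; [-]; _∷_)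
open import Data.List.Relation.Unary.Unique.Propositional using (Unique)
import Data.List.Relation.Unary.Unique.Propositional.Properties as Unique
open import Data.List.Relation.Binary.Disjoint.Propositional using (Disjoint)
open import Data.List.Relation.Binary.Permutation.Propositional using (_↭_; ↭-refl; ↭-sym; prep; ↭⇒↭ₛ; module PermutationReasoning)
import Data.List.Relation.Binary.Permutation.Propositional.Properties as ↭
import Data.List.Relation.Binary.Permutation.Setoid.Properties as ↭ₛ
open import Relation.Nullary using (¬_; Dec; yes; no; contradiction; ¬?)
open import Relation.Nullary.Decidable using (_×-dec_; _→-dec_; decidable-stable; from-yes; toSum)
open import Relation.Binary.Definitions using (tri<; tri≈; tri>)
open import Relation.Binary.PropositionalEquality using (_≡_; _≢_; refl; sym; trans; cong; cong₂; subst; module ≡-Reasoning)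
open import Relation.Binary.PropositionalEquality.Properties using (setoid)
open import Algebra.Bundles using (AbelianGroup; RawGroup)
open import Algebra.Structures using (IsAbelianGroup)
open import Algebra.Morphism.Structures using (IsGroupMonomorphism)
import Algebra.Morphism.GroupMonomorphism as GroupMonomorphism
import Algebra.Properties.AbelianGroup as AbelianGroupProperties
import Algebra.Properties.Monoid.Mult as Mult

-- Lists without repetition

∉-cons : ∀ {A : Set} {x : A} {xs} → x ∉ xs → Unique xs → Unique (x ∷ xs)
∉-cons x∉ u = ¬Any⇒All¬ _ x∉ ∷ u

Unique-resp-↭ : ∀ {A : Set} {xs ys : List A} → xs ↭ ys → Unique xs → Unique ys
Unique-resp-↭ p = ↭ₛ.Unique-resp-↭ (setoid _) (↭⇒↭ₛ p)

Unique-++⁻ʳ : ∀ {A : Set} (xs : List A) {ys} → Unique (xs ++ ys) → Unique ys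
Unique-++⁻ʳ []       u       = u
Unique-++⁻ʳ (_ ∷ xs) (_ ∷ u) = Unique-++⁻ʳ xs u

map-injective-on : ∀ {A B : Set} {f : A → B} {xs} → Unique (map f xs) →
                   ∀ {x y} → x ∈ xs → y ∈ xs → f x ≡ f y → x ≡ y
map-injective-on (f≢ ∷ u) (here refl) (here refl) _ = refl
map-injective-on {f = f} (f≢ ∷ u) (here refl) (there y∈) e = contradiction e (All.lookup f≢ (∈-map⁺ f y∈))
map-injective-on {f = f} (f≢ ∷ u) (there x∈) (here refl) e = contradiction (sym e) (All.lookup f≢ (∈-map⁺ f x∈))
map-injective-on (f≢ ∷ u) (there x∈) (there y∈) e = map-injective-on u x∈ y∈ e

-- Otherwise every element has a position in `xs`, and positions would inject `Fin k` into
-- `Fin (length xs)`.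
fresh : ∀ {k} (xs : List (Fin k)) → length xs < k → ∃ λ x → x ∉ xs
fresh {k} xs short with Fin.any? (λ x → ¬? (_∈?_ Fin._≟_ x xs))
... | yes found = found
... | no  none  = contradiction (Fin.injective⇒≤ index-inj) (ℕ.<⇒≱ short)
  where
  member : ∀ x → x ∈ xs
  member x = decidable-stable (_∈?_ Fin._≟_ x xs) (λ x∉ → none (x , x∉))
  index-inj : ∀ {x y} → index (member x) ≡ index (member y) → x ≡ y
  index-inj = index-injective (setoid _) (member _) (member _)

-- The result is recorded as a permutation because lengths, sums and freedom from repetition all
-- pass along `_↭_`.
complement : ∀ {k} (xs : List (Fin k)) → Unique xs → ∃ λ ys → xs ++ ys ↭ allFin k
complement {k} []       _ = allFin k , ↭-refl
complement {k} (x ∷ xs) (x∉ ∷ u) with complement xs u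
... | ys , p with ∈-++⁻ xs (↭.∈-resp-↭ (↭-sym p) (∈-allFin x))
...   | inj₁ x∈xs = contradiction x∈xs (All¬⇒¬Any x∉)
...   | inj₂ x∈ys with ∈-∃++ x∈ys
...     | ls , rs , refl = ls ++ rs , (begin
  x ∷ xs ++ ls ++ rs       ≡⟨ cong (x ∷_) (++-assoc xs ls rs) ⟨
  x ∷ (xs ++ ls) ++ rs     ↭⟨ ↭.shift x (xs ++ ls) rs ⟨
  (xs ++ ls) ++ x ∷ rs     ≡⟨ ++-assoc xs ls (x ∷ rs) ⟩
  xs ++ ls ++ x ∷ rs       ↭⟨ p ⟩
  allFin k                 ∎)
  where open PermutationReasoning

module _ {k : ℕ} (xs : List (Fin k)) {ys} (p : xs ++ ys ↭ allFin k) where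

  complement-unique : Unique (xs ++ ys)
  complement-unique = Unique-resp-↭ (↭-sym p) (Unique.allFin⁺ k)

  complement-length : length xs + length ys ≡ k
  complement-length = begin
    length xs + length ys  ≡⟨ length-++ xs ⟨
    length (xs ++ ys)      ≡⟨ ↭.↭-length p ⟩
    length (allFin k)      ≡⟨ length-tabulate (λ x → x) ⟩
    k                      ∎
    where open ≡-Reasoning

Unique⇒↭allFin : ∀ {k} {xs : List (Fin k)} → Unique xs → length xs ≡ k → xs ↭ allFin k
Unique⇒↭allFin {k} {xs} u len with complement xs u
... | []     , p = subst (_↭ allFin k) (++-identityʳ xs) p
... | y ∷ ys , p = contradiction (trans (cong (_+ length (y ∷ ys)) (sym len)) (complement-length xs p)) (ℕ.m+1+n≢m k)

-- Finite abelian groups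

-- Fixing the carrier `Fin k` with propositional equality makes elements decidable and enumerable;
-- arbitrary groups of order `k` are reduced to this form later.
record FinGroup (k : ℕ) : Set where
  infixl 7 _∙_
  infix  8 _⁻¹
  field
    _∙_            : Fin k → Fin k → Fin k
    ε              : Fin k
    _⁻¹            : Fin k → Fin k
    isAbelianGroup : IsAbelianGroup _≡_ _∙_ ε _⁻¹

  abelianGroup : AbelianGroup 0ℓ 0ℓ
  abelianGroup = record { isAbelianGroup = isAbelianGroup }

module Group {k : ℕ} (𝔾 : FinGroup k) where
  open FinGroup 𝔾 public
  open AbelianGroup abelianGroup public
    using (assoc; comm; identityˡ; identityʳ; inverseˡ; inverseʳ; isCommutativeMonoid; monoid)
  open AbelianGroupProperties abelianGroup public
    using (∙-cancelˡ; ∙-cancelʳ; inverseˡ-unique; ⁻¹-involutive; ⁻¹-injective; ⁻¹-∙-comm; ε⁻¹≈ε)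
  open Mult monoid public using () renaming (_×_ to _·_; ×-homo-+ to ·-homo-+; ×-assocˡ to ·-assocˡ)

  cancel-right : ∀ x y → x ∙ y ∙ y ⁻¹ ≡ x
  cancel-right x y = trans (assoc x y (y ⁻¹)) (trans (cong (x ∙_) (inverseʳ y)) (identityʳ x))

  cancel-left : ∀ x y → x ∙ y ⁻¹ ∙ y ≡ x
  cancel-left x y = trans (assoc x (y ⁻¹) y) (trans (cong (x ∙_) (inverseˡ y)) (identityʳ x))

  solve-right : ∀ {x y z} → x ∙ y ≡ z → x ≡ z ∙ y ⁻¹
  solve-right {x} {y} e = trans (sym (cancel-right x y)) (cong (_∙ y ⁻¹) e)

  solve-left : ∀ {x y z} → x ∙ y ≡ z → y ≡ z ∙ x ⁻¹
  solve-left {x} {y} e = solve-right (trans (comm y x) e)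

  quotient-swap : ∀ {t x y} → t ∙ x ⁻¹ ≡ y → x ≡ t ∙ y ⁻¹
  quotient-swap {t} {x} {y} e = solve-left (trans (sym (cong (_∙ x) e)) (cancel-left t x))

  interchange : ∀ w x y z → (w ∙ x) ∙ (y ∙ z) ≡ (w ∙ y) ∙ (x ∙ z)
  interchange w x y z = begin
    (w ∙ x) ∙ (y ∙ z)  ≡⟨ assoc w x (y ∙ z) ⟩
    w ∙ (x ∙ (y ∙ z))  ≡⟨ cong (w ∙_) (assoc x y z) ⟨
    w ∙ (x ∙ y ∙ z)    ≡⟨ cong (λ s → w ∙ (s ∙ z)) (comm x y) ⟩
    w ∙ (y ∙ x ∙ z)    ≡⟨ cong (w ∙_) (assoc y x z) ⟩
    w ∙ (y ∙ (x ∙ z))  ≡⟨ assoc w y (x ∙ z) ⟨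
    (w ∙ y) ∙ (x ∙ z)  ∎
    where open ≡-Reasoning

  ∑ : List (Fin k) → Fin k
  ∑ = foldr _∙_ ε

  ∑-↭ : ∀ {xs ys} → xs ↭ ys → ∑ xs ≡ ∑ ys
  ∑-↭ p = ↭ₛ.foldr-commMonoid (setoid _) isCommutativeMonoid (↭⇒↭ₛ p)

  ∑-++ : ∀ xs ys → ∑ (xs ++ ys) ≡ ∑ xs ∙ ∑ ys
  ∑-++ []       ys = sym (identityˡ _)
  ∑-++ (x ∷ xs) ys = trans (cong (x ∙_) (∑-++ xs ys)) (sym (assoc x _ _))

  ∑-translate : ∀ x ys → ∑ (map (x ∙_) ys) ≡ length ys · x ∙ ∑ ys
  ∑-translate x []       = sym (identityˡ ε)
  ∑-translate x (y ∷ ys) = trans (cong (x ∙ y ∙_) (∑-translate x ys)) (interchange x y _ _)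

  ∑-⁻¹ : ∀ xs → ∑ (map _⁻¹ xs) ≡ (∑ xs) ⁻¹
  ∑-⁻¹ []       = sym ε⁻¹≈ε
  ∑-⁻¹ (x ∷ xs) = trans (cong (x ⁻¹ ∙_) (∑-⁻¹ xs)) (⁻¹-∙-comm x _)

  σ : Fin k
  σ = ∑ (allFin k)

  ∑-complement : ∀ xs {ys} → xs ++ ys ↭ allFin k → ∑ xs ∙ ∑ ys ≡ σ
  ∑-complement xs {ys} p = trans (sym (∑-++ xs ys)) (∑-↭ p)

  -- Injectivity makes the `k` images distinct, so they rearrange `allFin k`.
  ∑-map-injective : ∀ {f : Fin k → Fin k} → (∀ {x y} → f x ≡ f y → x ≡ y) → ∑ (map f (allFin k)) ≡ σ
  ∑-map-injective {f} inj = ∑-↭ (Unique⇒↭allFin (Unique.map⁺ inj (Unique.allFin⁺ k))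
                                   (trans (length-map f (allFin k)) (length-tabulate (λ x → x))))

  -- Translating all summands of σ by x permutes them, so k · x vanishes.
  order-annihilates : ∀ x → k · x ≡ ε
  order-annihilates x = ∙-cancelʳ σ _ _ (begin
    k · x ∙ σ                          ≡⟨ cong (λ m → m · x ∙ σ) (length-tabulate {n = k} (λ y → y)) ⟨
    length (allFin k) · x ∙ σ          ≡⟨ ∑-translate x (allFin k) ⟨
    ∑ (map (x ∙_) (allFin k))          ≡⟨ ∑-map-injective (∙-cancelˡ x _ _) ⟩
    σ                                  ≡⟨ identityˡ σ ⟨
    ε ∙ σ                              ∎)
    where open ≡-Reasoning

  ·-ε : ∀ n → n · ε ≡ ε
  ·-ε zero    = refl
  ·-ε (suc n) = trans (identityˡ _) (·-ε n)

  multiple-annihilates : ∀ {r x} → r · x ≡ ε → ∀ u → (u * r) · x ≡ ε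
  multiple-annihilates {r} {x} rx u = trans (sym (·-assocˡ x u r)) (trans (cong (u ·_) rx) (·-ε u))

  -- Groups of prime exponent have prime power order

  module PrimeExponent {r : ℕ} (r-prime : Prime r) (exponent : ∀ x → r · x ≡ ε) where

    private instance
      r≢0 : NonZero r
      r≢0 = prime⇒nonZero r-prime

    r>1 : 1 < r
    r>1 = nonTrivial⇒n>1 r {{prime⇒nonTrivial r-prime}}

    record IsSubgroup (H : List (Fin k)) : Set where
      field
        unique   : Unique H
        ε∈       : ε ∈ H
        ∙-closed : ∀ {x y} → x ∈ H → y ∈ H → x ∙ y ∈ H

      ·-closed : ∀ n {x} → x ∈ H → n · x ∈ H
      ·-closed zero    x∈ = ε∈
      ·-closed (suc n) x∈ = ∙-closed x∈ (·-closed n x∈)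

      -- In exponent `r` the inverse of `x` is the multiple `(r ∸ 1) · x`, so closure under `_∙_`
      -- suffices.
      ⁻¹-closed : ∀ {x} → x ∈ H → x ⁻¹ ∈ H
      ⁻¹-closed {x} x∈ = subst (_∈ H) (inverseˡ-unique _ x eq) (·-closed (r ∸ 1) x∈)
        where
        open ≡-Reasoning
        eq : (r ∸ 1) · x ∙ x ≡ ε
        eq = begin
          (r ∸ 1) · x ∙ x      ≡⟨ comm _ x ⟩
          suc (r ∸ 1) · x      ≡⟨ cong (_· x) (ℕ.m+[n∸m]≡n (ℕ.<⇒≤ r>1)) ⟩
          r · x                ≡⟨ exponent x ⟩
          ε                    ∎

    module Extend {H : List (Fin k)} (sub : IsSubgroup H) (x : Fin k) where
      open IsSubgroup sub

      -- Since `t` is coprime to the prime `r`, a Bézout identity makes `x` or its inverse a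
      -- multiple of `t · x`.
      root∈ : ∀ {t} → 0 < t → t < r → t · x ∈ H → x ∈ H
      root∈ {suc t} _ t<r tx∈ with coprime-Bézout (prime⇒coprime r-prime t<r)
      ... | Bézout.-+ y s e = subst (_∈ H) eq (·-closed s tx∈)
        where
        open ≡-Reasoning
        eq : s · (suc t · x) ≡ x
        eq = begin
          s · (suc t · x)     ≡⟨ ·-assocˡ x s (suc t) ⟩
          (s * suc t) · x     ≡⟨ cong (_· x) e ⟨
          x ∙ (y * r) · x     ≡⟨ cong (x ∙_) (multiple-annihilates (exponent x) y) ⟩
          x ∙ ε               ≡⟨ identityʳ x ⟩
          x                   ∎
      ... | Bézout.+- y s e = subst (_∈ H) (sym (inverseˡ-unique x _ eq)) (⁻¹-closed (·-closed s tx∈))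
        where
        open ≡-Reasoning
        eq : x ∙ s · (suc t · x) ≡ ε
        eq = begin
          x ∙ s · (suc t · x)    ≡⟨ cong (x ∙_) (·-assocˡ x s (suc t)) ⟩
          (1 + s * suc t) · x    ≡⟨ cong (_· x) e ⟩
          (y * r) · x            ≡⟨ multiple-annihilates (exponent x) y ⟩
          ε                      ∎

      -- For `i = r` this lists the subgroup generated by `H` and `x`; smaller `i` serve the
      -- induction on disjointness.
      cosets : ℕ → List (Fin k)
      cosets zero    = []
      cosets (suc i) = map (i · x ∙_) H ++ cosets i

      length-cosets : ∀ i → length (cosets i) ≡ i * length H
      length-cosets zero    = refl
      length-cosets (suc i) = trans (length-++ (map (i · x ∙_) H)) (cong₂ _+_ (length-map _ H) (length-cosets i))

      ∈-cosets⁻ : ∀ i {y} → y ∈ cosets i → ∃₂ λ j h → j < i × h ∈ H × y ≡ j · x ∙ h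
      ∈-cosets⁻ (suc i) y∈ with ∈-++⁻ (map (i · x ∙_) H) y∈
      ... | inj₁ y∈H with ∈-map⁻ _ y∈H
      ...   | h , h∈ , e = i , h , ℕ.≤-refl , h∈ , e
      ∈-cosets⁻ (suc i) y∈ | inj₂ y∈′ with ∈-cosets⁻ i y∈′
      ...   | j , h , j<i , rest = j , h , ℕ.m≤n⇒m≤1+n j<i , rest

      ∈-cosets⁺ : ∀ i {j h} → j < i → h ∈ H → j · x ∙ h ∈ cosets i
      ∈-cosets⁺ (suc i) {j} (s≤s j≤i) h∈ with ℕ.m≤n⇒m<n∨m≡n j≤i
      ... | inj₁ j<i  = ∈-++⁺ʳ (map (i · x ∙_) H) (∈-cosets⁺ i j<i h∈)
      ... | inj₂ refl = ∈-++⁺ˡ (∈-map⁺ _ h∈)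

      -- If the cosets of `i · x` and `j · x` met for some `j < i`, then `(i ∸ j) · x` would lie in
      -- `H`, and with it `x`, because `0 < i ∸ j < r`.
      cosets-unique : x ∉ H → ∀ i → i ≤ r → Unique (cosets i)
      cosets-unique x∉ zero    _   = []
      cosets-unique x∉ (suc i) i<r =
        Unique.++⁺ (Unique.map⁺ (∙-cancelˡ _ _ _) unique) (cosets-unique x∉ i (ℕ.<⇒≤ i<r)) disjoint
        where
        disjoint : Disjoint (map (i · x ∙_) H) (cosets i)
        disjoint (y∈₁ , y∈₂) with ∈-map⁻ _ y∈₁ | ∈-cosets⁻ i y∈₂
        ... | h , h∈ , refl | j , h′ , j<i , h′∈ , e =
          x∉ (root∈ (ℕ.m<n⇒0<n∸m j<i) (ℕ.≤-<-trans (ℕ.m∸n≤m i j) i<r)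
                    (subst (_∈ H) (sym (solve-right eq)) (∙-closed h′∈ (⁻¹-closed h∈))))
          where
          open ≡-Reasoning
          eq : (i ∸ j) · x ∙ h ≡ h′
          eq = ∙-cancelˡ (j · x) _ _ (begin
            j · x ∙ ((i ∸ j) · x ∙ h)  ≡⟨ assoc _ _ _ ⟨
            j · x ∙ (i ∸ j) · x ∙ h    ≡⟨ cong (_∙ h) (·-homo-+ x j (i ∸ j)) ⟨
            (j + (i ∸ j)) · x ∙ h      ≡⟨ cong (λ n → n · x ∙ h) (ℕ.m+[n∸m]≡n (ℕ.<⇒≤ j<i)) ⟩
            i · x ∙ h                  ≡⟨ e ⟩
            j · x ∙ h′                 ∎)

      ·-mod : ∀ n → n · x ≡ (n % r) · x
      ·-mod n = begin
        n · x                                ≡⟨ cong (_· x) (m≡m%n+[m/n]*n n r) ⟩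
        (n % r + n / r * r) · x              ≡⟨ ·-homo-+ x (n % r) _ ⟩
        (n % r) · x ∙ (n / r * r) · x        ≡⟨ cong ((n % r) · x ∙_) (multiple-annihilates (exponent x) (n / r)) ⟩
        (n % r) · x ∙ ε                      ≡⟨ identityʳ _ ⟩
        (n % r) · x                          ∎
        where open ≡-Reasoning

      extend : x ∉ H → IsSubgroup (cosets r)
      extend x∉ = record
        { unique   = cosets-unique x∉ r ℕ.≤-refl
        ; ε∈       = subst (_∈ cosets r) (identityˡ ε) (∈-cosets⁺ r (ℕ.<⇒≤ r>1) ε∈)
        ; ∙-closed = closed
        }
        where
        closed : ∀ {y z} → y ∈ cosets r → z ∈ cosets r → y ∙ z ∈ cosets r
        closed y∈ z∈ with ∈-cosets⁻ r y∈ | ∈-cosets⁻ r z∈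
        ... | i , h , _ , h∈ , refl | j , h′ , _ , h′∈ , refl =
          subst (_∈ cosets r) (sym eq) (∈-cosets⁺ r (m%n<n (i + j) r) (∙-closed h∈ h′∈))
          where
          open ≡-Reasoning
          eq : (i · x ∙ h) ∙ (j · x ∙ h′) ≡ ((i + j) % r) · x ∙ (h ∙ h′)
          eq = begin
            (i · x ∙ h) ∙ (j · x ∙ h′)        ≡⟨ interchange _ _ _ _ ⟩
            (i · x ∙ j · x) ∙ (h ∙ h′)        ≡⟨ cong (_∙ (h ∙ h′)) (·-homo-+ x i j) ⟨
            (i + j) · x ∙ (h ∙ h′)            ≡⟨ cong (_∙ (h ∙ h′)) (·-mod (i + j)) ⟩
            ((i + j) % r) · x ∙ (h ∙ h′)      ∎

    -- `fuel` bounds the number of elements outside `H`. While some are left, adjoining a fresh one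
    -- multiplies the length by `r`, hence adds at least one element.
    grow : ∀ fuel q H → IsSubgroup H → length H ≡ r ^ q → k ≤ fuel + length H → ∃ λ p → k ≡ r ^ p
    grow zero q H sub len k≤ with complement H (IsSubgroup.unique sub)
    ... | ys , p = q , trans (ℕ.≤-antisym k≤ (subst (length H ≤_) (complement-length H p) (ℕ.m≤m+n _ _))) len
    grow (suc fuel) q H sub len k≤ with length H ℕ.<? k
    ... | no  full  = grow zero q H sub len (ℕ.≮⇒≥ full)
    ... | yes short with fresh H short
    ...   | x , x∉ = grow fuel (suc q) (cosets r) (extend x∉)
                       (trans (length-cosets r) (cong (r *_) len))
                       (ℕ.≤-trans k≤ (subst (_≤ fuel + length (cosets r)) (ℕ.+-suc fuel _) (ℕ.+-monoʳ-≤ fuel bigger)))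
      where
      open Extend sub x
      nonempty : ∀ {L : List (Fin k)} → ε ∈ L → 0 < length L
      nonempty (here _)  = s≤s z≤n
      nonempty (there _) = s≤s z≤n
      bigger : suc (length H) ≤ length (cosets r)
      bigger = begin
        suc (length H)           ≤⟨ ℕ.+-monoˡ-≤ (length H) (nonempty (IsSubgroup.ε∈ sub)) ⟩
        length H + length H      ≡⟨ cong (length H +_) (ℕ.+-identityʳ (length H)) ⟨
        2 * length H             ≤⟨ ℕ.*-monoˡ-≤ (length H) r>1 ⟩
        r * length H             ≡⟨ length-cosets r ⟨
        length (cosets r)        ∎
        where open ℕ.≤-Reasoning

    order-prime-power : ∃ λ p → k ≡ r ^ p
    order-prime-power = grow k 0 (ε ∷ []) trivial refl (ℕ.m≤m+n k 1)
      where
      trivial : IsSubgroup (ε ∷ [])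
      trivial = record
        { unique   = [] ∷ []
        ; ε∈       = here refl
        ; ∙-closed = λ { (here refl) (here refl) → here (identityˡ ε) }
        }

-- Label sets with prescribed sum

halve : ∀ m → ∃ λ j → m ≡ j * 2 ⊎ m ≡ suc (j * 2)
halve zero    = 0 , inj₁ refl
halve (suc m) with halve m
... | j , inj₁ refl = j , inj₂ refl
... | j , inj₂ refl = suc j , inj₁ refl

module Labels {k : ℕ} (𝔾 : FinGroup k) where
  open Group 𝔾

  -- Candidates for the `m` child edges below an edge labelled `a`. Uniqueness of the longer list
  -- says at once that the labels are distinct and avoid `ε` and `a`.
  ZeroSumSet : ℕ → Fin k → Set
  ZeroSumSet m a = ∃ λ B → length B ≡ m × Unique (ε ∷ a ∷ B) × ∑ B ≡ ε

  -- The last condition keeps the weight of the root away from every label at the root, since such a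
  -- label is the usual weight of the child it leads to.
  RootSet : ℕ → Set
  RootSet m = ∃ λ S → length S ≡ m × Unique (ε ∷ S) × ∑ S ∉ S

  -- With a zero-sum B the weight of the vertex is the label a of the edge to its parent.
  extension : 3 < k → ∀ {m a w} → 0 < m → a ≢ ε → a ≢ w → (2 ≤ m → ZeroSumSet m a) →
              ∃ λ B → length B ≡ m × Unique (a ∷ B) × ε ∉ B × a ∙ ∑ B ≢ w × a ∙ ∑ B ∉ B
  extension 3<k {suc zero} {a} {w} _ a≢ε a≢w _
    -- The weight will be `a ∙ x`. The third forbidden value keeps it from being `w`, and `a ≢ ε`
    -- keeps it from being `x`.
    with x , x∉ ← fresh (ε ∷ a ∷ w ∙ a ⁻¹ ∷ []) 3<k =
      x ∷ [] , refl , (x∉ ∘ there ∘ here ∘ sym ∷ []) ∷ [] ∷ []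
    , (λ { (here e) → x∉ (here (sym e)) })
    , (λ e → x∉ (there (there (here (solve-left (trans (cong (a ∙_) (sym (identityʳ x))) e))))))
    , (λ { (here e) → a≢ε (∙-cancelʳ x _ _ (trans (trans (cong (a ∙_) (sym (identityʳ x))) e) (sym (identityˡ x)))) })
  extension 3<k {suc (suc m)} {a} {w} _ a≢ε a≢w zs
    with zs (s≤s (s≤s z≤n))
  ... | B , len , (ε∉ ∷ a∉ ∷ u) , sum =
      B , len , a∉ ∷ u , (λ ε∈ → All¬⇒¬Any ε∉ (there ε∈))
    , (λ e → a≢w (trans (sym a∙∑B≡a) e)) , (λ w∈ → All¬⇒¬Any a∉ (subst (_∈ B) a∙∑B≡a w∈))
    where
    a∙∑B≡a : a ∙ ∑ B ≡ a
    a∙∑B≡a = trans (cong (a ∙_) sum) (identityʳ a)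

  module OddOrder (odd : k % 2 ≡ 1) where

    -- Even multiples of such an `x` vanish, and so does `k · x`; as `k` is odd, `x` itself
    -- vanishes.
    involution-free : ∀ {x} → x ∙ x ≡ ε → x ≡ ε
    involution-free {x} xx = begin
      x                               ≡⟨ identityʳ x ⟨
      x ∙ ε                           ≡⟨ cong (x ∙_) (multiple-annihilates {2} (trans (cong (x ∙_) (identityʳ x)) xx) (k / 2)) ⟨
      (1 + k / 2 * 2) · x             ≡⟨ cong (λ i → (i + k / 2 * 2) · x) odd ⟨
      (k % 2 + k / 2 * 2) · x         ≡⟨ cong (_· x) (m≡m%n+[m/n]*n k 2) ⟨
      k · x                           ≡⟨ order-annihilates x ⟩
      ε                               ∎
      where open ≡-Reasoning

    square-injective : ∀ {x y} → x ∙ x ≡ y ∙ y → x ≡ y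
    square-injective {x} {y} e = trans (sym (cancel-left x y)) (trans (cong (_∙ y) (involution-free eq)) (identityˡ y))
      where
      open ≡-Reasoning
      eq : (x ∙ y ⁻¹) ∙ (x ∙ y ⁻¹) ≡ ε
      eq = begin
        (x ∙ y ⁻¹) ∙ (x ∙ y ⁻¹)      ≡⟨ interchange _ _ _ _ ⟩
        (x ∙ x) ∙ (y ⁻¹ ∙ y ⁻¹)      ≡⟨ cong₂ _∙_ e (⁻¹-∙-comm y y) ⟩
        (y ∙ y) ∙ (y ∙ y) ⁻¹         ≡⟨ inverseʳ _ ⟩
        ε                            ∎

    ⁻¹-fixed-point-free : ∀ {x} → x ≢ ε → x ≢ x ⁻¹
    ⁻¹-fixed-point-free {x} x≢ε e = x≢ε (involution-free (trans (cong (x ∙_) e) (inverseʳ x)))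

    -- Inversion permutes the group, so `σ` is its own inverse.
    σ≡ε : σ ≡ ε
    σ≡ε = involution-free (trans (cong (σ ∙_) σ≡σ⁻¹) (inverseʳ σ))
      where
      σ≡σ⁻¹ : σ ≡ σ ⁻¹
      σ≡σ⁻¹ = trans (sym (∑-map-injective ⁻¹-injective)) (∑-⁻¹ (allFin k))

    -- Each round adds a fresh `x` and its inverse to the forbidden list `F`. Only `x` has to be
    -- searched for, since symmetry of `F` keeps `x ⁻¹` outside as well; this is why the bound is
    -- `suc k` and not `k`.
    pairs : ∀ j F → (∀ {x} → x ∈ F → x ⁻¹ ∈ F) → ε ∈ F → length F + j * 2 ≤ suc k →
            ∃ λ B → length B ≡ j * 2 × Unique B × (∀ {x} → x ∈ B → x ∉ F) × ∑ B ≡ ε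
    pairs zero    F _ _ _ = [] , refl , [] , (λ ()) , refl
    pairs (suc j) F symF ε∈F room
      with fresh F (ℕ.≤-pred (ℕ.≤-trans (subst (_≤ length F + suc j * 2) (ℕ.+-comm (length F) 2) (ℕ.+-monoʳ-≤ (length F) (ℕ.m≤m+n 2 (j * 2)))) room))
    ... | x , x∉F
      with pairs j (x ∷ x ⁻¹ ∷ F)
             (λ { (here refl) → there (here refl)
                ; (there (here refl)) → here (⁻¹-involutive x)
                ; (there (there y∈)) → there (there (symF y∈)) })
             (there (there ε∈F))
             (subst (_≤ suc k) (trans (ℕ.+-suc (length F) (suc (j * 2))) (cong suc (ℕ.+-suc (length F) (j * 2)))) room)
    ... | B , len , u , B∉ , sum =
        x ∷ x ⁻¹ ∷ B , cong (suc ∘ suc) len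
      , ∉-cons (λ { (here e) → ⁻¹-fixed-point-free (λ { refl → x∉F ε∈F }) e ; (there x∈) → B∉ x∈ (here refl) })
          (∉-cons (λ x⁻¹∈ → B∉ x⁻¹∈ (there (here refl))) u)
      , (λ { (here refl) → x∉F
           ; (there (here refl)) x⁻¹∈ → x∉F (subst (_∈ F) (⁻¹-involutive x) (symF x⁻¹∈))
           ; (there (there y∈)) y∈F → B∉ y∈ (there (there y∈F)) })
      , (begin
          x ∙ (x ⁻¹ ∙ ∑ B)   ≡⟨ cong (λ s → x ∙ (x ⁻¹ ∙ s)) sum ⟩
          x ∙ (x ⁻¹ ∙ ε)     ≡⟨ cong (x ∙_) (identityʳ _) ⟩
          x ∙ x ⁻¹           ≡⟨ inverseʳ x ⟩
          ε                  ∎)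
      where open ≡-Reasoning

    -- An element y for which {a⁻¹, y⁻¹, a ∙ y} is a zero-sum triple that avoids ε and a
    -- and meets no inverse pair twice.
    triple-generator : 5 < k → ∀ a → ∃ λ y → y ≢ ε × y ≢ a × y ≢ a ⁻¹ × y ≢ a ⁻¹ ∙ a ⁻¹ × y ∙ y ≢ a ⁻¹
    -- Squaring is injective, so `y ∙ y ≢ a ⁻¹` rules out at most one further value `h`.
    triple-generator 5<k a with Fin.any? (λ h → (h ∙ h) Fin.≟ a ⁻¹)
    ... | yes (h , hh) with y , y∉ ← fresh (ε ∷ a ∷ a ⁻¹ ∷ a ⁻¹ ∙ a ⁻¹ ∷ h ∷ []) 5<k =
        y , y∉ ∘ here , y∉ ∘ there ∘ here , y∉ ∘ there ∘ there ∘ here , y∉ ∘ there ∘ there ∘ there ∘ here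
      , λ yy → y∉ (there (there (there (there (here (square-injective (trans yy (sym hh))))))))
    ... | no none with y , y∉ ← fresh (ε ∷ a ∷ a ⁻¹ ∷ a ⁻¹ ∙ a ⁻¹ ∷ []) (ℕ.<⇒≤ 5<k) =
        y , y∉ ∘ here , y∉ ∘ there ∘ here , y∉ ∘ there ∘ there ∘ here , y∉ ∘ there ∘ there ∘ there ∘ here
      , λ yy → none (y , yy)

    even-zero-sum : ∀ j {a} → a ≢ ε → j * 2 + 3 ≤ k → ZeroSumSet (j * 2) a
    even-zero-sum j {a} a≢ε room
      with pairs j (ε ∷ a ∷ a ⁻¹ ∷ [])
             (λ { (here refl) → here ε⁻¹≈ε
                ; (there (here refl)) → there (there (here refl))
                ; (there (there (here refl))) → there (here (⁻¹-involutive a)) })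
             (here refl)
             (ℕ.m≤n⇒m≤1+n (subst (_≤ k) (ℕ.+-comm (j * 2) 3) room))
    ... | B , len , u , B∉ , sum =
        B , len
      , ∉-cons (λ { (here e) → a≢ε (sym e) ; (there ε∈) → B∉ ε∈ (here refl) })
          (∉-cons (λ a∈ → B∉ a∈ (there (here refl))) u)
      , sum

    odd-zero-sum : ∀ j {a} → a ≢ ε → 3 + j * 2 + 3 ≤ k → ZeroSumSet (3 + j * 2) a
    odd-zero-sum j {a} a≢ε room
      with triple-generator (ℕ.≤-trans (s≤s (s≤s (s≤s (ℕ.m≤n+m 3 (j * 2))))) room) a
    ... | y , y≢ε , y≢a , y≢a⁻¹ , y≢a⁻² , y²≢a⁻¹
      -- The forbidden list is `ε` with the triple and its inverses. It has length `7` where the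
      -- hypothesis on `k` leaves room for `6`; the bound `suc k` in `pairs` covers the difference.
      with pairs j (ε ∷ a ∷ a ⁻¹ ∷ y ∷ y ⁻¹ ∷ a ∙ y ∷ (a ∙ y) ⁻¹ ∷ [])
             (λ { (here refl) → here ε⁻¹≈ε
                ; (there (here refl)) → there (there (here refl))
                ; (there (there (here refl))) → there (here (⁻¹-involutive a))
                ; (there (there (there (here refl)))) → there (there (there (there (here refl))))
                ; (there (there (there (there (here refl))))) → there (there (there (here (⁻¹-involutive y))))
                ; (there (there (there (there (there (here refl)))))) → there (there (there (there (there (there (here refl))))))
                ; (there (there (there (there (there (there (here refl))))))) → there (there (there (there (there (here (⁻¹-involutive (a ∙ y)))))))
                })
             (here refl)
             (s≤s (subst (_≤ k) (cong (3 +_) (ℕ.+-comm (j * 2) 3)) room))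
    ... | B , len , u , B∉ , sum =
        a ⁻¹ ∷ y ⁻¹ ∷ a ∙ y ∷ B , cong (3 +_) len
      , ∉-cons (λ { (here e) → a≢ε (sym e)
                  ; (there (here e)) → a≢ε (trans (sym (⁻¹-involutive a)) (trans (cong _⁻¹ (sym e)) ε⁻¹≈ε))
                  ; (there (there (here e))) → y≢ε (trans (sym (⁻¹-involutive y)) (trans (cong _⁻¹ (sym e)) ε⁻¹≈ε))
                  ; (there (there (there (here e)))) → y≢a⁻¹ (trans (solve-left (sym e)) (identityˡ _))
                  ; (there (there (there (there ε∈)))) → B∉ ε∈ (here refl) })
          (∉-cons (λ { (here e) → ⁻¹-fixed-point-free a≢ε e
                     ; (there (here e)) → y≢a⁻¹ (trans (sym (⁻¹-involutive y)) (cong _⁻¹ (sym e)))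
                     ; (there (there (here e))) → y≢ε (∙-cancelˡ a y ε (trans (sym e) (sym (identityʳ a))))
                     ; (there (there (there a∈))) → B∉ a∈ (there (here refl)) })
          (∉-cons (λ { (here e) → y≢a (sym (⁻¹-injective e))
                     ; (there (here e)) → y≢a⁻² (solve-left (sym e))
                     ; (there (there x∈)) → B∉ x∈ (there (there (here refl))) })
          (∉-cons (λ { (here e) → y²≢a⁻¹ (trans (solve-left (trans (sym (assoc a y y)) (trans (cong (_∙ y) (sym e)) (inverseˡ y)))) (identityˡ _))
                     ; (there x∈) → B∉ x∈ (there (there (there (there (here refl))))) })
          (∉-cons (λ x∈ → B∉ x∈ (there (there (there (there (there (here refl))))))) u))))
      , (begin
          a ⁻¹ ∙ (y ⁻¹ ∙ (a ∙ y ∙ ∑ B))    ≡⟨ assoc _ _ _ ⟨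
          a ⁻¹ ∙ y ⁻¹ ∙ (a ∙ y ∙ ∑ B)      ≡⟨ cong₂ _∙_ (⁻¹-∙-comm a y) (trans (cong (a ∙ y ∙_) sum) (identityʳ _)) ⟩
          (a ∙ y) ⁻¹ ∙ (a ∙ y)             ≡⟨ inverseˡ _ ⟩
          ε                                ∎)
      where open ≡-Reasoning

    zero-sum : ∀ {m a} → a ≢ ε → 2 ≤ m → m + 3 ≤ k → ZeroSumSet m a
    zero-sum {m} a≢ε 2≤m room with halve m
    ... | j     , inj₁ refl = even-zero-sum j a≢ε room
    ... | suc j , inj₂ refl = odd-zero-sum j a≢ε room
    ... | zero  , inj₂ refl = contradiction 2≤m (λ { (s≤s ()) })

    -- A zero-sum set for any `a ≢ ε` will do, as its sum `ε` is not among its labels.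
    root-set : ∀ {m} → 2 ≤ m → m + 3 ≤ k → RootSet m
    root-set {m} 2≤m room with fresh (ε ∷ []) (ℕ.≤-trans (s≤s (s≤s z≤n)) (ℕ.≤-trans (ℕ.m≤n+m 3 m) room))
    ... | a , a∉ with zero-sum {a = a} (a∉ ∘ here) 2≤m room
    ...   | B , len , ((_ ∷ ε∉) ∷ (_ ∷ u)) , sum = B , len , ε∉ ∷ u , λ w∈ → All¬⇒¬Any ε∉ (subst (_∈ B) sum w∈)

    -- Leaving out b and b⁻² gives weight b; the label ε goes to an edge at a leaf.
    pendant-root-set : ∀ {b} → 3 · b ≢ ε → ∃ λ R → 3 + length R ≡ k × Unique (ε ∷ R) × ∑ (ε ∷ R) ∉ ε ∷ R
    pendant-root-set {b} 3b≢ε with complement xs xs-unique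
      where
      xs : List (Fin k)
      xs = b ∷ (b ∙ b) ⁻¹ ∷ ε ∷ []
      b≢ε : b ≢ ε
      b≢ε refl = 3b≢ε (·-ε 3)
      xs-unique : Unique xs
      -- The two omitted labels differ because `3 · b ≢ ε`; the second is not `ε` because there are
      -- no involutions.
      xs-unique = ((λ e → 3b≢ε (trans (cong (λ s → b ∙ (b ∙ s)) (identityʳ b)) (trans (cong (_∙ (b ∙ b)) e) (inverseˡ _)))) ∷ b≢ε ∷ [])
                ∷ ((λ e → b≢ε (involution-free (trans (sym (⁻¹-involutive _)) (trans (cong _⁻¹ e) ε⁻¹≈ε)))) ∷ [])
                ∷ [] ∷ []
    ... | R , p with complement-unique (b ∷ (b ∙ b) ⁻¹ ∷ ε ∷ []) p
    ...   | (_ ∷ b∉) ∷ _ ∷ u = R , complement-length (b ∷ (b ∙ b) ⁻¹ ∷ ε ∷ []) p , u , λ w∈ → All¬⇒¬Any b∉ (subst (_∈ ε ∷ R) sum w∈)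
      where
      open ≡-Reasoning
      -- The omitted labels add up to `b ⁻¹` and the whole group to `ε`, which leaves `b`, itself an
      -- omitted label.
      sum : ∑ (ε ∷ R) ≡ b
      sum = ∙-cancelˡ (∑ (b ∷ (b ∙ b) ⁻¹ ∷ [])) _ _ (begin
        ∑ (b ∷ (b ∙ b) ⁻¹ ∷ []) ∙ ∑ (ε ∷ R)   ≡⟨ ∑-complement (b ∷ (b ∙ b) ⁻¹ ∷ []) p ⟩
        σ                                     ≡⟨ σ≡ε ⟩
        ε                                     ≡⟨ inverseʳ (b ∙ b) ⟨
        (b ∙ b) ∙ (b ∙ b) ⁻¹                  ≡⟨ assoc b b _ ⟩
        b ∙ (b ∙ (b ∙ b) ⁻¹)                  ≡⟨ comm b _ ⟩
        b ∙ (b ∙ b) ⁻¹ ∙ b                    ≡⟨ cong (λ c → b ∙ c ∙ b) (identityʳ _) ⟨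
        ∑ (b ∷ (b ∙ b) ⁻¹ ∷ []) ∙ b           ∎)

  module NotExponentTwo (not-exponent-2 : ¬ (∀ x → x ∙ x ≡ ε)) where

    -- If almost all squares were equal to t, then for each h some x and x ∙ h would both have square t.
    avoid-square : ∀ L → length L + length L < k → ∀ t → ∃ λ b → b ∉ L × b ∙ b ≢ t
    avoid-square L room t with Fin.any? (λ b → ¬? (_∈?_ Fin._≟_ b L) ×-dec ¬? ((b ∙ b) Fin.≟ t))
    ... | yes found = found
    ... | no  none  = contradiction exponent-2 not-exponent-2
      where
      square : ∀ {b} → b ∉ L → b ∙ b ≡ t
      square {b} b∉ = decidable-stable ((b ∙ b) Fin.≟ t) (λ b²≢t → none (b , b∉ , b²≢t))
      exponent-2 : ∀ h → h ∙ h ≡ ε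
      -- Avoiding `L` and its translate by `h ⁻¹` puts both `x` and `x ∙ h` outside `L`; hence the
      -- doubled length in the hypothesis.
      exponent-2 h with fresh (L ++ map (_∙ h ⁻¹) L)
                          (subst (_< k) (sym (trans (length-++ L) (cong (length L +_) (length-map _ L)))) room)
      ... | x , x∉ = ∙-cancelˡ (x ∙ x) _ _ (begin
        (x ∙ x) ∙ (h ∙ h)   ≡⟨ interchange x x h h ⟩
        (x ∙ h) ∙ (x ∙ h)   ≡⟨ square (λ xh∈ → x∉ (∈-++⁺ʳ L (subst (_∈ map (_∙ h ⁻¹) L) (cancel-right x h) (∈-map⁺ (_∙ h ⁻¹) xh∈)))) ⟩
        t                   ≡⟨ square (λ x∈ → x∉ (∈-++⁺ˡ x∈)) ⟨
        x ∙ x               ≡⟨ identityʳ _ ⟨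
        (x ∙ x) ∙ ε         ∎)
        where open ≡-Reasoning

    quotient-∉ : ∀ {b t} L → b ∉ map (λ y → t ∙ y ⁻¹) L → t ∙ b ⁻¹ ∉ L
    quotient-∉ L b∉ tb⁻¹∈ = b∉ (subst (_∈ map _ L) (sym (quotient-swap refl)) (∈-map⁺ _ tb⁻¹∈))

    ∙-quotient : ∀ b t → b ∙ (t ∙ b ⁻¹) ≡ t
    ∙-quotient b t = trans (comm b _) (cancel-left t b)

    -- The complement of `b`, `c`, `ε`, `a` sums to `ε` once `b ∙ c` is `σ ∙ a ⁻¹`, so `b`
    -- determines `c`. Keeping both away from `ε` and `a` excludes four values of `b`, which
    -- `avoid-square` doubles to `8`; `b ≢ c` is its condition on the square.
    co-zero-sum : 8 < k → ∀ {a} → a ≢ ε → ∃ λ B → 4 + length B ≡ k × Unique (ε ∷ a ∷ B) × ∑ B ≡ ε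
    co-zero-sum 8<k {a} a≢ε
      with avoid-square (ε ∷ a ∷ map (λ y → σ ∙ a ⁻¹ ∙ y ⁻¹) (ε ∷ a ∷ [])) 8<k (σ ∙ a ⁻¹)
    ... | b , b∉ , b²≢ = result
      where
      open ≡-Reasoning
      c : Fin k
      c = σ ∙ a ⁻¹ ∙ b ⁻¹
      c∉ : c ∉ ε ∷ a ∷ []
      c∉ = quotient-∉ (ε ∷ a ∷ []) (b∉ ∘ there ∘ there)
      b≢c : b ≢ c
      b≢c e = b²≢ (trans (cong (b ∙_) e) (∙-quotient b _))
      xs : List (Fin k)
      xs = b ∷ c ∷ ε ∷ a ∷ []
      xs-unique : Unique xs
      xs-unique = (b≢c ∷ b∉ ∘ here ∷ b∉ ∘ there ∘ here ∷ []) ∷ (c∉ ∘ here ∷ c∉ ∘ there ∘ here ∷ [])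
                ∷ (a≢ε ∘ sym ∷ []) ∷ [] ∷ []
      ∑xs : ∑ xs ≡ σ
      ∑xs = begin
        b ∙ (c ∙ (ε ∙ (a ∙ ε)))   ≡⟨ assoc b c _ ⟨
        b ∙ c ∙ (ε ∙ (a ∙ ε))     ≡⟨ cong₂ _∙_ (∙-quotient b _) (trans (identityˡ _) (identityʳ a)) ⟩
        σ ∙ a ⁻¹ ∙ a              ≡⟨ cancel-left σ a ⟩
        σ                         ∎
      result : ∃ λ B → 4 + length B ≡ k × Unique (ε ∷ a ∷ B) × ∑ B ≡ ε
      result with complement xs xs-unique
      ... | B , p = B , complement-length xs p , Unique-++⁻ʳ (b ∷ c ∷ []) (complement-unique xs p)
                  , ∙-cancelˡ σ _ _ (trans (cong (_∙ ∑ B) (sym ∑xs)) (trans (∑-complement xs p) (sym (identityʳ σ))))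

    -- Here `b ∙ c` is `σ` and only `ε` must be avoided. The complement again has sum `ε` and does
    -- not contain it.
    co-root-set : 8 < k → ∃ λ S → 3 + length S ≡ k × Unique (ε ∷ S) × ∑ S ∉ S
    co-root-set 8<k
      with avoid-square (ε ∷ map (λ y → σ ∙ y ⁻¹) (ε ∷ [])) (ℕ.≤-trans (ℕ.m≤m+n 5 4) 8<k) σ
    ... | b , b∉ , b²≢ = result
      where
      open ≡-Reasoning
      c : Fin k
      c = σ ∙ b ⁻¹
      xs : List (Fin k)
      xs = b ∷ c ∷ ε ∷ []
      xs-unique : Unique xs
      xs-unique = ((λ e → b²≢ (trans (cong (b ∙_) e) (∙-quotient b _))) ∷ b∉ ∘ here ∷ [])
                ∷ (quotient-∉ (ε ∷ []) (b∉ ∘ there) ∘ here ∷ []) ∷ [] ∷ []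
      ∑xs : ∑ xs ≡ σ
      ∑xs = begin
        b ∙ (c ∙ (ε ∙ ε))   ≡⟨ cong (λ s → b ∙ (c ∙ s)) (identityˡ ε) ⟩
        b ∙ (c ∙ ε)         ≡⟨ cong (b ∙_) (identityʳ c) ⟩
        b ∙ c               ≡⟨ ∙-quotient b σ ⟩
        σ                   ∎
      result : ∃ λ S → 3 + length S ≡ k × Unique (ε ∷ S) × ∑ S ∉ S
      result with complement xs xs-unique
      ... | S , p with Unique-++⁻ʳ (b ∷ c ∷ []) (complement-unique xs p)
      ...   | ε∉ ∷ u = S , complement-length xs p , ε∉ ∷ u
                     , λ w∈ → All¬⇒¬Any ε∉ (subst (_∈ S) (∙-cancelˡ σ _ _ (trans (cong (_∙ ∑ S) (sym ∑xs)) (trans (∑-complement xs p) (sym (identityʳ σ))))) w∈)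

-- Removing and assigning list entries, maxima and minima

remove : ∀ {n} (x : Fin n) (xs : List (Fin n)) → List (Fin n)
remove x = filter (λ y → ¬? (y Fin.≟ x))

remove-∉ : ∀ {n} {x : Fin n} {xs} → x ∉ xs → remove x xs ≡ xs
remove-∉ x∉ = filter-all _ (All.map (_∘ sym) (¬Any⇒All¬ _ x∉))

↭-remove : ∀ {n} {x : Fin n} {xs} → Unique xs → x ∈ xs → xs ↭ x ∷ remove x xs
↭-remove {x = x} u x∈ with ∈-∃++ x∈
... | ys , zs , refl with Unique-resp-↭ (↭.shift x ys zs) u
...   | x∉ ∷ _ = begin
  ys ++ x ∷ zs                      ↭⟨ ↭.shift x ys zs ⟩
  x ∷ ys ++ zs                      ≡⟨ cong (x ∷_) (remove-∉ (All¬⇒¬Any x∉)) ⟨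
  x ∷ remove x (ys ++ zs)           ≡⟨ cong (x ∷_) (filter-reject (λ y → ¬? (y Fin.≟ x)) (λ x≢x → x≢x refl)) ⟨
  x ∷ remove x (x ∷ ys ++ zs)       ↭⟨ prep x (↭.filter-↭ _ (↭.shift x ys zs)) ⟨
  x ∷ remove x (ys ++ x ∷ zs)       ∎
  where open PermutationReasoning

-- The default `b` is the value outside `xs`. The equation has a form that lets `ys` be replaced by
-- `map g xs` through matching on `refl`.
assign : ∀ {n} {B : Set} → B → (xs : List (Fin n)) (ys : List B) → Unique xs → length ys ≡ length xs →
         ∃ λ g → map g xs ≡ ys
assign b []       []       _        _   = (λ _ → b) , refl
assign b (x ∷ xs) (y ∷ ys) (x∉ ∷ u) len with assign b xs ys u (ℕ.suc-injective len)
... | g , eq = h , cong₂ _∷_ at-x (trans (on-xs xs (All¬⇒¬Any x∉)) eq)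
  where
  h : _ → _
  h z with z Fin.≟ x
  ... | yes _ = y
  ... | no  _ = g z
  at-x : h x ≡ y
  at-x with x Fin.≟ x
  ... | yes _   = refl
  ... | no  x≢x = contradiction refl x≢x
  off-x : ∀ z → z ≢ x → h z ≡ g z
  off-x z z≢x with z Fin.≟ x
  ... | yes z≡x = contradiction z≡x z≢x
  ... | no  _   = refl
  on-xs : ∀ zs → x ∉ zs → map h zs ≡ map g zs
  on-xs []       _  = refl
  on-xs (z ∷ zs) x∉ = cong₂ _∷_ (off-x z (x∉ ∘ here ∘ sym)) (on-xs zs (x∉ ∘ there))

map-cong-∈ : ∀ {A B : Set} {f g : A → B} xs → (∀ {x} → x ∈ xs → f x ≡ g x) → map f xs ≡ map g xs
map-cong-∈ []       _  = refl
map-cong-∈ (x ∷ xs) eq = cong₂ _∷_ (eq (here refl)) (map-cong-∈ xs (eq ∘ there))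

maxℕ-≥ : ∀ m (f : Fin m → ℕ) i → f i ≤ maxℕ m f
maxℕ-≥ (suc m) f Fin.zero    = ℕ.m≤m⊔n _ _
maxℕ-≥ (suc m) f (Fin.suc i) = ℕ.m≤n⇒m≤o⊔n (f Fin.zero) (maxℕ-≥ m (f ∘ Fin.suc) i)

maxℕ-attained : ∀ m (f : Fin m → ℕ) → 0 < maxℕ m f → ∃ λ i → f i ≡ maxℕ m f
maxℕ-attained (suc m) f pos with ℕ.⊔-sel (f Fin.zero) (maxℕ m (f ∘ Fin.suc))
... | inj₁ eq = Fin.zero , sym eq
... | inj₂ eq with maxℕ-attained m (f ∘ Fin.suc) (subst (0 <_) eq pos)
...   | i , fi = Fin.suc i , trans fi (sym eq)

least : ∀ {P : ℕ → Set} → (∀ j → Dec (P j)) → ∀ {i} → P i → ∃ λ d → P d × (∀ {j} → j < d → ¬ P j)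
least {P} P? {i} Pi = search i 0 Pi′ λ ()
  where
  Pi′ : P (i + 0)
  Pi′ = subst P (sym (ℕ.+-identityʳ i)) Pi
  search : ∀ gap d → P (gap + d) → (∀ {j} → j < d → ¬ P j) → ∃ λ d → P d × (∀ {j} → j < d → ¬ P j)
  search zero      d Pd below = d , Pd , below
  search (suc gap) d Pg below with P? d
  ... | yes Pd = d , Pd , below
  ... | no ¬Pd = search gap (suc d) (subst P (sym (ℕ.+-suc gap d)) Pg) below′
    where
    below′ : ∀ {j} → j < suc d → ¬ P j
    below′ (s≤s j≤d) with ℕ.m≤n⇒m<n∨m≡n j≤d
    ... | inj₁ j<d  = below j<d
    ... | inj₂ refl = ¬Pd

-- Neighbourhoods, paths and breadth-first search

module Graph {n : ℕ} (G : SimpleGraph n) where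

  neighbours : Fin n → List (Fin n)
  neighbours v = filter (λ u → adj G v u Bool.≟ true) (allFin n)

  neighbours-unique : ∀ v → Unique (neighbours v)
  neighbours-unique v = Unique.filter⁺ _ (Unique.allFin⁺ n)

  ∈-neighbours⁺ : ∀ {v u} → Adj G v u → u ∈ neighbours v
  ∈-neighbours⁺ vu = ∈-filter⁺ _ (∈-allFin _) vu

  ∈-neighbours⁻ : ∀ {v u} → u ∈ neighbours v → Adj G v u
  ∈-neighbours⁻ {v} u∈ = proj₂ (∈-filter⁻ (λ u → adj G v u Bool.≟ true) {xs = allFin n} u∈)

  Adj-sym : ∀ {u v} → Adj G u v → Adj G v u
  Adj-sym {u} {v} uv = trans (SimpleGraph.sym G v u) uv

  Adj-irrefl : ∀ {v} → ¬ Adj G v v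
  Adj-irrefl {v} vv with trans (sym vv) (irrefl G v)
  ... | ()

  deg-length : ∀ v → deg G v ≡ length (neighbours v)
  deg-length v = go n (λ i → i)
    where
    -- Generalised over `h` because the sum and `tabulate` both recurse by composing with `Fin.suc`.
    go : ∀ m (h : Fin m → Fin n) →
         sumℕ m (λ i → if adj G v (h i) then 1 else 0) ≡ length (filter (λ u → adj G v u Bool.≟ true) (tabulate h))
    go zero    h = refl
    go (suc m) h with adj G v (h Fin.zero)
    ... | true  = cong suc (go m (h ∘ Fin.suc))
    ... | false = go m (h ∘ Fin.suc)

  -- `HasCycle` asks for a sequence on all of `ℕ`; `z` fills the positions beyond the end of the
  -- list.
  nth : Fin n → List (Fin n) → ℕ → Fin n
  nth z []       _       = z
  nth z (x ∷ xs) zero    = x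
  nth z (x ∷ xs) (suc i) = nth z xs i

  nth-∈ : ∀ z xs {i} → i < length xs → nth z xs i ∈ xs
  nth-∈ z (x ∷ xs) {zero}  _         = here refl
  nth-∈ z (x ∷ xs) {suc i} (s≤s i<) = there (nth-∈ z xs i<)

  nth-injective : ∀ z {xs} → Unique xs → ∀ i j → i < length xs → j < length xs → nth z xs i ≡ nth z xs j → i ≡ j
  nth-injective z (x∉ ∷ u) zero    zero    _        _        _ = refl
  nth-injective z (x∉ ∷ u) zero    (suc j) _        (s≤s j<) e = contradiction e (All.lookup x∉ (nth-∈ z _ j<))
  nth-injective z (x∉ ∷ u) (suc i) zero    (s≤s i<) _        e = contradiction (sym e) (All.lookup x∉ (nth-∈ z _ i<))
  nth-injective z (x∉ ∷ u) (suc i) (suc j) (s≤s i<) (s≤s j<) e = cong suc (nth-injective z u i j i< j< e)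

  nth-linked : ∀ z {xs} → Linked (Adj G) xs → ∀ i → suc i < length xs → Adj G (nth z xs i) (nth z xs (suc i))
  nth-linked z (xy ∷ l) zero    _        = xy
  nth-linked z (xy ∷ l) (suc i) (s≤s i<) = nth-linked z l i i<
  nth-linked z [-]      _       (s≤s ())

  nth-last : ∀ z x xs y → nth z (x ∷ xs ++ y ∷ []) (length (xs ++ y ∷ [])) ≡ y
  nth-last z x []       y = refl
  nth-last z x (w ∷ xs) y = nth-last z w xs y

  -- The nonempty middle part guarantees the three vertices that a cycle needs.
  closed-path⇒cycle : ∀ {x xs y} → Unique (x ∷ xs ++ y ∷ []) → Linked (Adj G) (x ∷ xs ++ y ∷ []) → 0 < length xs →
                      Adj G y x → HasCycle G
  closed-path⇒cycle {x} {xs@(w ∷ ws)} {y} u l _ yx =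
    length L , s≤s (s≤s (subst (1 ≤_) (sym (length-++ ws)) (ℕ.m≤n+m 1 (length ws))))
    , nth x L , nth-injective x u , nth-linked x l
    , subst (λ z → Adj G z x) (sym (nth-last x x xs y)) yx
    where
    L : List (Fin n)
    L = x ∷ xs ++ y ∷ []

  -- The properties of breadth-first search used below. The root is its own parent, so that `parent`
  -- is total and deleting the parent from the neighbours of `r` deletes nothing.
  record Rooted (r : Fin n) : Set where
    field
      parent      : Fin n → Fin n
      depth       : Fin n → ℕ
      depth-root  : depth r ≡ 0
      depth-zero  : ∀ {v} → depth v ≡ 0 → v ≡ r
      parent-root : parent r ≡ r
      parent-step : ∀ {v d} → depth v ≡ suc d → Adj G v (parent v) × depth (parent v) ≡ d
      depth-edge  : ∀ {u v} → Adj G u v → depth u ≤ suc (depth v)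

    -- Follow parents from x and y until they meet.
    bridge : ∀ d x y → depth x ≡ d → depth y ≡ d → x ≢ y →
             ∃ λ xs → 0 < length xs × All (λ z → depth z < d) xs × Unique xs
                    × (∀ {ys} → Linked (Adj G) (y ∷ ys) → Linked (Adj G) (x ∷ xs ++ y ∷ ys))
    bridge zero    x y dx dy x≢y = contradiction (trans (depth-zero dx) (sym (depth-zero dy))) x≢y
    bridge (suc d) x y dx dy x≢y with parent-step dx | parent-step dy | parent x Fin.≟ parent y
    ... | ax , dpx | ay , dpy | yes e =
        parent x ∷ [] , s≤s z≤n , s≤s (ℕ.≤-reflexive dpx) ∷ [] , [] ∷ []
      , λ l → ax ∷ subst (λ p → Adj G p y) (sym e) (Adj-sym ay) ∷ l
    ... | ax , dpx | ay , dpy | no px≢py with bridge d (parent x) (parent y) dpx dpy px≢py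
    ...   | xs , _ , low , u , link =
        parent x ∷ xs ++ parent y ∷ [] , s≤s z≤n
      , s≤s (ℕ.≤-reflexive dpx) ∷ AllProperties.++⁺ (All.map ℕ.m≤n⇒m≤1+n low) (s≤s (ℕ.≤-reflexive dpy) ∷ [])
      , Unique-resp-↭ (↭.∷↭∷ʳ (parent y) (parent x ∷ xs))
          (∉-cons (λ { (here e) → px≢py (sym e) ; (there py∈) → ∉-low dpy py∈ }) (∉-cons (∉-low dpx) u))
      , λ {ys} l → ax ∷ subst (λ zs → Linked (Adj G) (parent x ∷ zs)) (sym (++-assoc xs (parent y ∷ []) (y ∷ ys))) (link (Adj-sym ay ∷ l))
      where
      ∉-low : ∀ {z} → depth z ≡ d → z ∉ xs
      ∉-low dz z∈ = ℕ.<-irrefl dz (All.lookup low z∈)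

    module Acyclic (acyclic : ¬ HasCycle G) where

      -- The path given by `bridge` has all its inner vertices at smaller depth, so an edge between
      -- its ends would close it to a cycle.
      depths-differ : ∀ {u v} → Adj G u v → depth u ≢ depth v
      depths-differ {u} {v} uv e with bridge (depth v) u v e refl (λ { refl → Adj-irrefl uv })
      ... | xs , pos , low , uniq , link =
        acyclic (closed-path⇒cycle
          (Unique-resp-↭ (↭.∷↭∷ʳ v (u ∷ xs))
             (∉-cons (λ { (here refl) → Adj-irrefl uv ; (there v∈) → ∉-low refl v∈ }) (∉-cons (∉-low e) uniq)))
          (link [-]) pos (Adj-sym uv))
        where
        ∉-low : ∀ {z} → depth z ≡ depth v → z ∉ xs
        ∉-low dz z∈ = ℕ.<-irrefl dz (All.lookup low z∈)

      -- If `u` and `parent v` were different, `bridge` would join them by a path at smaller depths,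
      -- and `v` would close this path to a cycle.
      parent-unique : ∀ {u v} → Adj G u v → depth v ≡ suc (depth u) → parent v ≡ u
      parent-unique {u} {v} uv dv with parent v Fin.≟ u | parent-step dv
      ... | yes e    | _ = e
      ... | no  pv≢u | vp , dp with bridge (depth u) u (parent v) refl dp (pv≢u ∘ sym)
      ...   | xs , pos , low , uniq , link =
        contradiction (closed-path⇒cycle
          (Unique-resp-↭ (↭.∷↭∷ʳ (parent v) (v ∷ u ∷ xs))
            (∉-cons (λ { (here e) → ℕ.<-irrefl (trans (sym dp) (cong depth e)) (ℕ.≤-reflexive (sym dv)) ; (there (here e)) → pv≢u e ; (there (there p∈)) → ∉-low dp p∈ })
              (∉-cons (λ { (here refl) → Adj-irrefl uv ; (there v∈) → ℕ.<-asym (All.lookup low v∈) (ℕ.≤-reflexive (sym dv)) })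
                (∉-cons (∉-low refl) uniq))))
          (Adj-sym uv ∷ link [-]) (s≤s z≤n) (Adj-sym vp)) acyclic
        where
        ∉-low : ∀ {z} → depth z ≡ depth u → z ∉ xs
        ∉-low dz z∈ = ℕ.<-irrefl dz (All.lookup low z∈)

      edge-cases : ∀ {u v} → Adj G u v → (parent u ≡ v × depth u ≡ suc (depth v)) ⊎ (parent v ≡ u × depth v ≡ suc (depth u))
      edge-cases {u} {v} uv with ℕ.<-cmp (depth u) (depth v)
      ... | tri< u<v _ _ = let e = ℕ.≤-antisym (depth-edge (Adj-sym uv)) u<v in inj₂ (parent-unique uv e , e)
      ... | tri≈ _ e _   = contradiction e (depths-differ uv)
      ... | tri> _ _ v<u = let e = ℕ.≤-antisym (depth-edge uv) v<u in inj₁ (parent-unique (Adj-sym uv) e , e)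

  module BFS (r : Fin n) where

    -- Counting the exact length of a walk to `r` makes reachability decidable by recursion; the
    -- first step of a shortest walk leads to the parent.
    Reach : ℕ → Fin n → Set
    Reach zero    v = v ≡ r
    Reach (suc d) v = ∃ λ u → Adj G v u × Reach d u

    reach? : ∀ v d → Dec (Reach d v)
    reach? v zero    = v Fin.≟ r
    reach? v (suc d) = Fin.any? (λ u → (adj G v u Bool.≟ true) ×-dec reach? u d)

    walk⇒reach : ∀ {v} → Walk G v r → ∃ λ d → Reach d v
    walk⇒reach here          = 0 , refl
    walk⇒reach (step vu wlk) with walk⇒reach wlk
    ... | d , reach = suc d , _ , vu , reach

    module _ (conn : Connected G) where

      shortest : ∀ v → ∃ λ d → Reach d v × (∀ {j} → j < d → ¬ Reach j v)
      shortest v = least (reach? v) (proj₂ (walk⇒reach (conn v r)))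

      dist : Fin n → ℕ
      dist v = proj₁ (shortest v)

      reach-dist : ∀ v → Reach (dist v) v
      reach-dist v = proj₁ (proj₂ (shortest v))

      dist-≤ : ∀ {v d} → Reach d v → dist v ≤ d
      dist-≤ {v} reach = ℕ.≮⇒≥ (λ d< → proj₂ (proj₂ (shortest v)) d< reach)

      dist-edge : ∀ {u v} → Adj G u v → dist u ≤ suc (dist v)
      dist-edge uv = dist-≤ (_ , uv , reach-dist _)

      next : ∀ v d → Reach d v → Fin n
      next v zero    _       = v
      next v (suc d) (u , _) = u

      next-step : ∀ v d (reach : Reach d v) → dist v ≡ d → ∀ {d′} → d ≡ suc d′ →
                  Adj G v (next v d reach) × dist (next v d reach) ≡ d′
      next-step v (suc d) (u , vu , reach) e refl =
        vu , ℕ.≤-antisym (dist-≤ reach) (ℕ.≤-pred (subst (_≤ suc (dist u)) e (dist-edge vu)))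

      next-root : ∀ d (reach : Reach d r) → d ≡ 0 → next r d reach ≡ r
      next-root zero _ _ = refl

      rooted : Rooted r
      rooted = record
        { parent      = λ v → next v (dist v) (reach-dist v)
        ; depth       = dist
        ; depth-root  = dist-root
        ; depth-zero  = λ {v} e → subst (λ d → Reach d v) e (reach-dist v)
        ; parent-root = next-root (dist r) (reach-dist r) dist-root
        ; parent-step = λ {v} e → next-step v (dist v) (reach-dist v) refl e
        ; depth-edge  = dist-edge
        }
        where
        dist-root : dist r ≡ 0
        dist-root = ℕ.n≤0⇒n≡0 (dist-≤ {r} {0} refl)

-- Twin edge colourings of rooted trees

module Colouring {n : ℕ} (T : SimpleGraph n) (acyclic : ¬ HasCycle T) {r : Fin n} (rooted : Graph.Rooted T r)
                 {k : ℕ} (𝔾 : FinGroup k) (3<k : 3 < k) where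
  open Graph T
  open Rooted rooted
  open Acyclic acyclic
  open Group 𝔾
  open Labels 𝔾

  weight-∑ : ∀ f v → weight abelianGroup T f v ≡ ∑ (map (f v) (neighbours v))
  weight-∑ f v = go n (λ i → i)
    where
    go : ∀ m (h : Fin m → Fin n) →
         gsum abelianGroup m (λ i → if adj T v (h i) then f v (h i) else ε)
         ≡ ∑ (map (f v) (filter (λ u → adj T v u Bool.≟ true) (tabulate h)))
    go zero    h = refl
    go (suc m) h with adj T v (h Fin.zero)
    ... | true  = cong (f v (h Fin.zero) ∙_) (go m (h ∘ Fin.suc))
    ... | false = trans (identityˡ _) (go m (h ∘ Fin.suc))

  children : Fin n → List (Fin n)
  children v = remove (parent v) (neighbours v)

  ∈-children⁻ : ∀ {v x} → x ∈ children v → Adj T v x × x ≢ parent v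
  ∈-children⁻ {v} x∈ with ∈-filter⁻ (λ y → ¬? (y Fin.≟ parent v)) {xs = neighbours v} x∈
  ... | x∈′ , x≢ = ∈-neighbours⁻ x∈′ , x≢

  ∈-children⁺ : ∀ {v x} → Adj T v x → x ≢ parent v → x ∈ children v
  ∈-children⁺ vx x≢ = ∈-filter⁺ _ (∈-neighbours⁺ vx) x≢

  children-unique : ∀ v → Unique (children v)
  children-unique v = Unique.filter⁺ _ (neighbours-unique v)

  children-root : children r ≡ neighbours r
  children-root = remove-∉ (λ p∈ → Adj-irrefl (subst (Adj T r) parent-root (∈-neighbours⁻ p∈)))

  neighbours-↭ : ∀ {v} → Adj T v (parent v) → neighbours v ↭ parent v ∷ children v
  neighbours-↭ {v} vp = ↭-remove (neighbours-unique v) (∈-neighbours⁺ vp)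

  depth-parent : ∀ v → depth (parent v) ≤ depth v
  depth-parent v = go (depth v) refl
    where
    go : ∀ d → depth v ≡ d → depth (parent v) ≤ depth v
    go zero    e = ℕ.≤-reflexive (cong depth (subst (λ u → parent u ≡ u) (sym (depth-zero e)) parent-root))
    go (suc d) e = ℕ.≤-trans (ℕ.≤-reflexive (proj₂ (parent-step e))) (ℕ.≤-trans (ℕ.n≤1+n d) (ℕ.≤-reflexive (sym e)))

  parent-asym : ∀ {u v} → depth u ≡ suc (depth v) → parent v ≢ u
  parent-asym {u} {v} e refl = ℕ.1+n≰n (subst (_≤ depth v) e (depth-parent v))

  child-of-parent : ∀ {v d} → depth v ≡ suc d → v ∈ children (parent v)
  child-of-parent {v} e with parent-step e
  ... | vp , dp = ∈-children⁺ (Adj-sym vp) (λ v≡pp → parent-asym (trans e (cong suc (sym dp))) (sym v≡pp))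

  -- What the children of `v` need to know: the labels of the edges to them and the weight `total`
  -- of `v`. `≢total` allows a child to have its parent label as weight, and `nonzero` confines `ε`
  -- to edges at leaves.
  record Node (v : Fin n) : Set where
    field
      label    : Fin n → Fin k
      total    : Fin k
      ≢total   : ∀ {x} → x ∈ children v → label x ≢ total
      nonzero  : ∀ {x} → x ∈ children v → deg T x ≢ 1 → label x ≢ ε
  open Node

  -- With `u` as parent of `v`, the three parts are properness at `v`, the weight of `v`, and its
  -- difference from the weight of `u`.
  Compatible : ∀ {u v} → Node u → Node v → Set
  Compatible {u} {v} p q =
      Unique (label p v ∷ map (label q) (children v))
    × total q ≡ label p v ∙ ∑ (map (label q) (children v))
    × total q ≢ total p

  -- Common form of two cases: `ε` is avoided at the root, or it is used once, on the edge to a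
  -- leaf.
  RootLabelling : Set
  RootLabelling = ∃ λ (g : Fin n → Fin k) → Unique (map g (neighbours r))
    × (∀ {x} → x ∈ neighbours r → g x ≢ ∑ (map g (neighbours r)))
    × (∀ {x} → x ∈ neighbours r → deg T x ≢ 1 → g x ≢ ε)

  labelling-from-set : RootSet (deg T r) → RootLabelling
  labelling-from-set (S , len , (ε∉ ∷ u) , w∉)
    with assign ε (neighbours r) S (neighbours-unique r) (trans len (deg-length r))
  ... | g , refl = g , u , (λ x∈ e → w∉ (subst (_∈ map g (neighbours r)) e (∈-map⁺ g x∈)))
                 , λ x∈ _ e → All¬⇒¬Any ε∉ (subst (_∈ map g (neighbours r)) e (∈-map⁺ g x∈))

  -- Listing `l` first among the neighbours makes `assign` give it `ε`. Labels are distinct, so any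
  -- neighbour labelled `ε` is the leaf `l`.
  labelling-from-pendant : ∀ {l} → Adj T r l → deg T l ≡ 1 → ∀ {R} → suc (length R) ≡ deg T r →
                           Unique (ε ∷ R) → ∑ (ε ∷ R) ∉ ε ∷ R → RootLabelling
  labelling-from-pendant {l} rl leaf {R} len u w∉ = result
    where
    others : List (Fin n)
    others = remove l (neighbours r)
    p : neighbours r ↭ l ∷ others
    p = ↭-remove (neighbours-unique r) (∈-neighbours⁺ rl)
    result : RootLabelling
    result with assign ε (l ∷ others) (ε ∷ R) (Unique-resp-↭ p (neighbours-unique r))
                  (trans len (trans (deg-length r) (↭.↭-length p)))
    ... | g , eq =
        g , Unique-resp-↭ (↭-sym q) u
      , (λ x∈ e → w∉ (subst (_∈ ε ∷ R) (trans e (∑-↭ q)) (↭.∈-resp-↭ q (∈-map⁺ g x∈))))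
      , nonzero′
      where
      q : map g (neighbours r) ↭ ε ∷ R
      q = subst (map g (neighbours r) ↭_) eq (↭.map⁺ g p)
      nonzero′ : ∀ {x} → x ∈ neighbours r → deg T x ≢ 1 → g x ≢ ε
      nonzero′ {x} x∈ inner e =
        inner (subst (λ y → deg T y ≡ 1)
          (map-injective-on {f = g} (subst Unique (sym eq) u) (here refl) (↭.∈-resp-↭ p x∈) (trans (l↦ε eq) (sym e))) leaf)
        where
        l↦ε : map g (l ∷ others) ≡ ε ∷ R → g l ≡ ε
        l↦ε refl = refl

  module _ (zero-sums : ∀ v → 3 ≤ deg T v → ∀ {a} → a ≢ ε → ZeroSumSet (deg T v ∸ 1) a)
           (root-labelling : RootLabelling) where

    inner-labels : ∀ v {a w} → suc (length (children v)) ≡ deg T v → (deg T v ≢ 1 → a ≢ ε) → a ≢ w →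
                   ∃ λ B → length B ≡ length (children v) × Unique (a ∷ B) × ε ∉ B × a ∙ ∑ B ≢ w × a ∙ ∑ B ∉ B
    inner-labels v {a} len a≢ε a≢w with deg T v ℕ.≟ 1
    -- A leaf has no children and therefore weight `a`, which differs from `w` by hypothesis.
    ... | yes leaf = [] , ℕ.suc-injective (trans (sym leaf) (sym len)) , [] ∷ [] , (λ ()) , (λ e → a≢w (trans (sym (identityʳ a)) e)) , (λ ())
    ... | no inner = extension 3<k (ℕ.n≢0⇒n>0 (λ e → inner (trans (sym len) (cong suc e)))) (a≢ε inner) a≢w
                       (λ 2≤m → subst (λ m → ZeroSumSet m a) (cong (_∸ 1) (sym len))
                                  (zero-sums v (subst (3 ≤_) len (s≤s 2≤m)) (a≢ε inner)))

    descend : ∀ {v d} → depth v ≡ suc d → (p : Node (parent v)) → Σ (Node v) (Compatible p)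
    descend {v} e p
      with inner-labels v {label p v} {total p}
             (sym (trans (deg-length v) (↭.↭-length (neighbours-↭ (proj₁ (parent-step e))))))
             (nonzero p (child-of-parent e)) (≢total p (child-of-parent e))
    ... | B , len , u , ε∉ , ≢w , ∉B with assign ε (children v) B (children-unique v) len
    ...   | g , refl =
      record
        { label   = g
        ; total   = label p v ∙ ∑ (map g (children v))
        ; ≢total  = λ x∈ eq → ∉B (subst (_∈ map g (children v)) eq (∈-map⁺ g x∈))
        ; nonzero = λ x∈ _ eq → ε∉ (subst (_∈ map g (children v)) eq (∈-map⁺ g x∈))
        }
      , u , refl , ≢w

    root-node : Node r
    root-node = record
      { label   = proj₁ root-labelling
      ; total   = ∑ (map (proj₁ root-labelling) (neighbours r))
      ; ≢total  = λ x∈ → proj₁ (proj₂ (proj₂ root-labelling)) (subst (_ ∈_) children-root x∈)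
      ; nonzero = λ x∈ → proj₂ (proj₂ (proj₂ root-labelling)) (subst (_ ∈_) children-root x∈)
      }

    -- The depth is a separate argument so that the recursion is structural; `build-node` removes
    -- the dependence on it.
    build : ∀ d v → depth v ≡ d → Node v
    build zero    v e = subst Node (sym (depth-zero e)) root-node
    build (suc d) v e = proj₁ (descend e (build d (parent v) (proj₂ (parent-step e))))

    node : ∀ v → Node v
    node v = build (depth v) v refl

    build-node : ∀ {d v} (e : depth v ≡ d) → build d v e ≡ node v
    build-node refl = refl

    compatible : ∀ {v d} → depth v ≡ suc d → Compatible (node (parent v)) (node v)
    compatible {v} {d} e = subst (Compatible (node (parent v))) (build-node e)
      (subst (λ p → Compatible p (build (suc d) v e)) (build-node (proj₂ (parent-step e)))
        (proj₂ (descend e (build d (parent v) (proj₂ (parent-step e))))))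

    -- Takes the place of `Compatible` at the root, which has no parent edge.
    Summed : ∀ v → Node v → Set
    Summed v q = Unique (map (label q) (children v)) × total q ≡ ∑ (map (label q) (children v))

    summed-root : ∀ {v} → depth v ≡ 0 → Summed v (node v)
    summed-root {v} e = subst (Summed v) (build-node e) (go (depth-zero e))
      where
      go : ∀ {u} (e : u ≡ r) → Summed u (subst Node (sym e) root-node)
      go refl = subst (λ xs → Unique (map (proj₁ root-labelling) xs)
                            × ∑ (map (proj₁ root-labelling) (neighbours r)) ≡ ∑ (map (proj₁ root-labelling) xs))
                      (sym children-root) (proj₁ (proj₂ root-labelling) , refl)

    -- Labels are stored at the upper end of an edge, and the test decides which end that is.
    colour : Fin n → Fin n → Fin k
    colour u v with parent u Fin.≟ v
    ... | yes _ = label (node v) u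
    ... | no  _ = label (node u) v

    colour-up : ∀ u → colour u (parent u) ≡ label (node (parent u)) u
    colour-up u with parent u Fin.≟ parent u
    ... | yes _  = refl
    ... | no  ne = contradiction refl ne

    colour-down : ∀ {u v} → parent u ≢ v → colour u v ≡ label (node u) v
    colour-down {u} {v} ne with parent u Fin.≟ v
    ... | yes e = contradiction e ne
    ... | no  _ = refl

    colour-parent-sym : ∀ {u v} → parent u ≡ v → depth u ≡ suc (depth v) → colour u v ≡ colour v u
    colour-parent-sym {u} refl e = trans (colour-up u) (sym (colour-down (parent-asym e)))

    colour-children : ∀ v → map (colour v) (children v) ≡ map (label (node v)) (children v)
    colour-children v = map-cong-∈ (children v) (λ x∈ → colour-down (proj₂ (∈-children⁻ x∈) ∘ sym))

    local : ∀ v → Unique (map (colour v) (neighbours v)) × ∑ (map (colour v) (neighbours v)) ≡ total (node v)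
    local v = go (depth v) refl
      where
      go : ∀ d → depth v ≡ d → Unique (map (colour v) (neighbours v)) × ∑ (map (colour v) (neighbours v)) ≡ total (node v)
      go zero e with summed-root e
      ... | u , sum = subst Unique eq u , trans (cong ∑ (sym eq)) (sym sum)
        where
        eq : map (label (node v)) (children v) ≡ map (colour v) (neighbours v)
        eq = trans (sym (colour-children v))
                   (cong (map (colour v)) (subst (λ u → children u ≡ neighbours u) (sym (depth-zero e)) children-root))
      go (suc d) e with compatible e
      ... | u , sum , _ = Unique-resp-↭ (↭-sym p) u , trans (∑-↭ p) (sym sum)
        where
        p : map (colour v) (neighbours v) ↭ label (node (parent v)) v ∷ map (label (node v)) (children v)
        p = subst (map (colour v) (neighbours v) ↭_) (cong₂ _∷_ (colour-up v) (colour-children v))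
              (↭.map⁺ (colour v) (neighbours-↭ (proj₁ (parent-step e))))

    weight-total : ∀ v → weight abelianGroup T colour v ≡ total (node v)
    weight-total v = trans (weight-∑ colour v) (proj₂ (local v))

    totals-differ : ∀ {u v} → parent u ≡ v → depth u ≡ suc (depth v) → weight abelianGroup T colour u ≢ weight abelianGroup T colour v
    totals-differ {u} refl e eq with compatible e
    ... | _ , _ , ne = ne (trans (sym (weight-total u)) (trans eq (weight-total (parent u))))

    twin-colouring : HasTwinColoring abelianGroup T
    twin-colouring = colour , symmetric , proper , distinct
      where
      symmetric : ∀ u v → Adj T u v → colour u v ≡ colour v u
      symmetric u v uv with edge-cases uv
      ... | inj₁ (e , d) = colour-parent-sym e d
      ... | inj₂ (e , d) = sym (colour-parent-sym e d)
      proper : ∀ u v w → Adj T u v → Adj T u w → v ≢ w → colour u v ≢ colour u w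
      proper u v w uv uw v≢w e = v≢w (map-injective-on (proj₁ (local u)) (∈-neighbours⁺ uv) (∈-neighbours⁺ uw) e)
      distinct : ∀ u v → Adj T u v → weight abelianGroup T colour u ≢ weight abelianGroup T colour v
      distinct u v uv with edge-cases uv
      ... | inj₁ (e , d) = totals-differ e d
      ... | inj₂ (e , d) = totals-differ e d ∘ sym

-- Replacing the carrier of a group of order k by Fin k

module Transport {c ℓ : Level} (A : AbelianGroup c ℓ) {k : ℕ} (order : HasOrder A k) where
  private module A = AbelianGroup A
  open Bijection order using (to; injective; strictlySurjective) renaming (cong to to-cong)

  from : Fin k → A.Carrier
  from i = proj₁ (strictlySurjective i)

  to-from : ∀ i → to (from i) ≡ i
  to-from i = proj₂ (strictlySurjective i)

  from-to : ∀ x → from (to x) A.≈ x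
  from-to x = injective (to-from (to x))

  rawGroup : RawGroup 0ℓ 0ℓ
  rawGroup = record
    { Carrier = Fin k
    ; _≈_     = _≡_
    ; _∙_     = λ i j → to (from i A.∙ from j)
    ; ε       = to A.ε
    ; _⁻¹     = λ i → to (from i A.⁻¹)
    }

  from-injective : ∀ {i j} → from i A.≈ from j → i ≡ j
  from-injective {i} {j} e = trans (sym (to-from i)) (trans (to-cong e) (to-from j))

  -- The operations were carried over through `to`, which makes `from` an injective homomorphism;
  -- the group laws on `Fin k` are then inherited from `A`.
  from-isMonomorphism : IsGroupMonomorphism rawGroup A.rawGroup from
  from-isMonomorphism = record
    { isGroupHomomorphism = record
      { isMonoidHomomorphism = record
        { isMagmaHomomorphism = record
          { isRelHomomorphism = record { cong = λ { refl → A.refl } }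
          ; homo = λ i j → from-to _
          }
        ; ε-homo = from-to _
        }
      ; ⁻¹-homo = λ i → from-to _
      }
    ; injective = from-injective
    }

  finGroup : FinGroup k
  finGroup = record { isAbelianGroup = GroupMonomorphism.isAbelianGroup from-isMonomorphism A.isAbelianGroup }

  open FinGroup finGroup using (abelianGroup; ε)

  from-weight : ∀ {n} (G : SimpleGraph n) f v → weight A G (λ x y → from (f x y)) v A.≈ from (weight abelianGroup G f v)
  from-weight {n} G f v = go n (λ i → i)
    where
    go : ∀ m (h : Fin m → Fin n) →
         gsum A m (λ i → if adj G v (h i) then from (f v (h i)) else A.ε)
         A.≈ from (gsum abelianGroup m (λ i → if adj G v (h i) then f v (h i) else ε))
    go zero    h = A.sym (from-to _)
    go (suc m) h with adj G v (h Fin.zero)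
    ... | true  = A.trans (A.∙-congˡ (go m (h ∘ Fin.suc))) (A.sym (from-to _))
    ... | false = A.trans (A.∙-cong (A.sym (from-to _)) (go m (h ∘ Fin.suc))) (A.sym (from-to _))

  transport-colouring : ∀ {n} (G : SimpleGraph n) → HasTwinColoring abelianGroup G → HasTwinColoring A G
  transport-colouring G (f , symmetric , proper , distinct) =
      (λ u v → from (f u v))
    , (λ u v uv → A.reflexive (cong from (symmetric u v uv)))
    , (λ u v w uv uw v≢w e → proper u v w uv uw v≢w (from-injective e))
    , (λ u v uv e → distinct u v uv (from-injective (A.trans (A.sym (from-weight G f u)) (A.trans e (from-weight G f v)))))

-- Leaves and degrees in trees

singleton-≡ : ∀ {A : Set} {xs : List A} → length xs ≡ 1 → ∀ {x y} → x ∈ xs → y ∈ xs → x ≡ y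
singleton-≡ {xs = _ ∷ []} _ (here refl) (here refl) = refl

prime[3] : Prime 3
prime[3] = from-yes (prime? 3)

module Trees {n : ℕ} (T : SimpleGraph n) (conn : Connected T) (acyclic : ¬ HasCycle T)
             (rooted : ∀ r → Graph.Rooted T r) (3≤n : 3 ≤ n) where
  open Graph T

  neighbour : ∀ v → ∃ λ u → Adj T v u
  neighbour v with fresh (v ∷ []) (ℕ.≤-trans (s≤s (s≤s z≤n)) 3≤n)
  ... | w , w∉ with conn v w
  ...   | here      = contradiction (here refl) w∉
  ...   | step vu _ = _ , vu

  deg>0 : ∀ v → 0 < deg T v
  deg>0 v = subst (0 <_) (sym (deg-length v)) (nonempty (∈-neighbours⁺ (proj₂ (neighbour v))))
    where
    nonempty : ∀ {u} {us : List (Fin n)} → u ∈ us → 0 < length us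
    nonempty (here _)  = s≤s z≤n
    nonempty (there _) = s≤s z≤n

  deg≥2 : ∀ {v} → deg T v ≢ 1 → 2 ≤ deg T v
  deg≥2 {v} inner = ℕ.≤∧≢⇒< (deg>0 v) (inner ∘ sym)

  leaf-neighbour-unique : ∀ {u x y} → deg T u ≡ 1 → Adj T u x → Adj T u y → x ≡ y
  leaf-neighbour-unique {u} leaf ux uy =
    singleton-≡ (trans (sym (deg-length u)) leaf) (∈-neighbours⁺ ux) (∈-neighbours⁺ uy)

  -- No walk leaves a pair of adjacent leaves, whereas `3 ≤ n` provides a third vertex.
  leaves-not-adjacent : ∀ {u v} → Adj T u v → deg T u ≡ 1 → deg T v ≢ 1
  leaves-not-adjacent {u} {v} uv leaf-u leaf-v with fresh (u ∷ v ∷ []) 3≤n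
  ... | w , w∉ = w∉ (stays (here refl) (conn u w))
    where
    stays : ∀ {x} → x ∈ u ∷ v ∷ [] → Walk T x w → w ∈ u ∷ v ∷ []
    stays x∈                  here          = x∈
    stays (here refl)         (step xy wlk) = stays (there (here (leaf-neighbour-unique leaf-u xy uv))) wlk
    stays (there (here refl)) (step xy wlk) = stays (here (leaf-neighbour-unique leaf-v xy (Adj-sym uv))) wlk

  inner-vertex : ∃ λ v → deg T v ≢ 1
  inner-vertex with fresh {n} [] (ℕ.≤-trans (s≤s z≤n) 3≤n)
  ... | v , _ with deg T v ℕ.≟ 1 | neighbour v
  ...   | no inner | _      = v , inner
  ...   | yes leaf | u , vu = u , leaves-not-adjacent vu leaf

  deg≤Δ : ∀ v → deg T v ≤ Δ T
  deg≤Δ = maxℕ-≥ n (deg T)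

  Δ≥2 : 2 ≤ Δ T
  Δ≥2 = ℕ.≤-trans (deg≥2 (proj₂ inner-vertex)) (deg≤Δ _)

  -- The maximum degree is attained, and at an inner vertex because it is at least `2`.
  regular-degree : ∀ {d} → IsRegularTree T d → d ≡ Δ T
  regular-degree regular with maxℕ-attained n (deg T) (ℕ.<⇒≤ Δ≥2)
  ... | v , dv = trans (sym (regular v (λ leaf → ℕ.<-irrefl (trans (sym leaf) dv) Δ≥2))) dv

  irregular-vertex : ¬ IsRegularTree T (Δ T) → ∃ λ v → deg T v ≢ 1 × deg T v < Δ T
  irregular-vertex ¬regular
    with Fin.any? (λ v → ¬? (deg T v ℕ.≟ 1) ×-dec (deg T v ℕ.<? Δ T))
  ... | yes found = found
  ... | no  none  = contradiction (λ v inner → ℕ.≤-antisym (deg≤Δ v) (ℕ.≮⇒≥ (λ lt → none (v , inner , lt)))) ¬regular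

  regular? : Dec (IsRegularTree T (Δ T))
  regular? = Fin.all? (λ v → ¬? (deg T v ℕ.≟ 1) →-dec (deg T v ℕ.≟ Δ T))

  -- A neighbour other than the parent would be a child and hence deeper.
  deepest-is-leaf : ∀ {r} (R : Rooted r) (let open Rooted R) v → (∀ u → depth u ≤ depth v) → deg T v ≡ 1
  deepest-is-leaf R v deepest = trans (deg-length v)
    (ℕ.≤-antisym (at-most-one (neighbours-unique v) only-parent) (subst (0 <_) (deg-length v) (deg>0 v)))
    where
    open Rooted R
    open Acyclic acyclic
    only-parent : ∀ {x} → x ∈ neighbours v → x ≡ parent v
    only-parent {x} x∈ with edge-cases (∈-neighbours⁻ x∈)
    ... | inj₁ (e , _) = sym e
    ... | inj₂ (_ , d) = contradiction (deepest x) (ℕ.<⇒≱ (ℕ.≤-reflexive (sym d)))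
    at-most-one : ∀ {y} {xs : List (Fin n)} → Unique xs → (∀ {x} → x ∈ xs → x ≡ y) → length xs ≤ 1
    at-most-one []                   _    = z≤n
    at-most-one (_ ∷ [])             _    = s≤s z≤n
    at-most-one ((ne ∷ _) ∷ (_ ∷ _)) same = contradiction (trans (same (here refl)) (sym (same (there (here refl))))) ne

  leaf-exists : ∃ λ v → deg T v ≡ 1
  leaf-exists = _ , deepest-is-leaf (rooted r) (argmax depth r (allFin n))
                      (λ u → All.lookup (f[xs]≤f[argmax] {f = depth} r (allFin n)) (∈-allFin u))
    where
    r : Fin n
    r = proj₁ inner-vertex
    open Rooted (rooted r)

  -- Choice of root and label sets in each case

  module _ {k : ℕ} (𝔾 : FinGroup k) (3<k : 3 < k) where
    open Group 𝔾
    open Labels 𝔾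

    private module C (r : Fin n) = Colouring T acyclic (rooted r) 𝔾 3<k

    -- Below the root the parent edge is already labelled, so order `Δ T + 2` is enough, whereas
    -- `root-set` asks for `deg T r + 3`.
    odd-zero-sums : k % 2 ≡ 1 → Δ T + 2 ≤ k → ∀ v → 3 ≤ deg T v → ∀ {a} → a ≢ ε → ZeroSumSet (deg T v ∸ 1) a
    odd-zero-sums odd room v 3≤deg a≢ε = OddOrder.zero-sum odd a≢ε (ℕ.∸-monoˡ-≤ 1 3≤deg) (begin
      deg T v ∸ 1 + 3        ≡⟨ ℕ.+-assoc (deg T v ∸ 1) 1 2 ⟨
      deg T v ∸ 1 + 1 + 2    ≡⟨ cong (_+ 2) (ℕ.m∸n+n≡m (deg>0 v)) ⟩
      deg T v + 2            ≤⟨ ℕ.+-monoˡ-≤ 2 (deg≤Δ v) ⟩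
      Δ T + 2                ≤⟨ room ⟩
      k                      ∎)
      where open ℕ.≤-Reasoning

    colouring-odd : k % 2 ≡ 1 → Δ T + 2 ≤ k → ∀ r → deg T r ≢ 1 → deg T r + 3 ≤ k → HasTwinColoring abelianGroup T
    colouring-odd odd room r inner room-r = 
      (C.twin-colouring r (odd-zero-sums odd room)
        (C.labelling-from-set r (OddOrder.root-set odd (deg≥2 inner) room-r)))

    -- The root uses all but two of the `k` labels. This matches its degree, since a neighbour of a
    -- leaf is an inner vertex of the regular tree.
    colouring-pendant : k % 2 ≡ 1 → Δ T + 2 ≡ k → IsRegularTree T (Δ T) → ∀ {b} → 3 · b ≢ ε →
                        ∀ {r l} → Adj T l r → deg T l ≡ 1 → HasTwinColoring abelianGroup T
    colouring-pendant odd Δ+2≡k regular 3b≢ε {r} lr leaf with OddOrder.pendant-root-set odd 3b≢ε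
    ... | R , len , u , w∉ =
      C.twin-colouring r (odd-zero-sums odd (ℕ.≤-reflexive Δ+2≡k))
        (C.labelling-from-pendant r (Adj-sym lr) leaf len-R u w∉)
      where
      open ≡-Reasoning
      len-R : suc (length R) ≡ deg T r
      len-R = ℕ.+-cancelˡ-≡ 2 _ _ (begin
        3 + length R  ≡⟨ len ⟩
        k             ≡⟨ Δ+2≡k ⟨
        Δ T + 2       ≡⟨ cong (_+ 2) (regular r (leaves-not-adjacent lr leaf)) ⟨
        deg T r + 2   ≡⟨ ℕ.+-comm (deg T r) 2 ⟩
        2 + deg T r   ∎)

    -- If `3 · b` vanished for all `b`, the order would be a power of `3`; finiteness turns the
    -- failure of this into an explicit `b`.
    colouring-regular-odd : k % 2 ≡ 1 → Δ T + 2 ≡ k → IsRegularTree T (Δ T) → (∀ p → k ≢ 3 ^ p) → HasTwinColoring abelianGroup T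
    colouring-regular-odd odd Δ+2≡k regular not-power =
      colouring-pendant odd Δ+2≡k regular (proj₂ element) (proj₂ (neighbour (proj₁ leaf-exists))) (proj₂ leaf-exists)
      where
      not-exponent-3 : ¬ (∀ b → 3 · b ≡ ε)
      not-exponent-3 exponent-3 = let p , k≡ = PrimeExponent.order-prime-power prime[3] exponent-3 in not-power p k≡
      element : ∃ λ b → 3 · b ≢ ε
      element = Fin.¬∀⟶∃¬ k _ (λ b → (3 · b) Fin.≟ ε) not-exponent-3

    -- The label sets have the fixed sizes `k ∸ 3` at the root and `k ∸ 4` below it; they fit
    -- because all inner vertices have degree `Δ T`.
    colouring-regular : 8 < k → Δ T + 3 ≡ k → IsRegularTree T (Δ T) → (∀ q → k ≢ 2 ^ q) → HasTwinColoring abelianGroup T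
    colouring-regular 8<k Δ+3≡k regular not-power =
      C.twin-colouring r zero-sums (C.labelling-from-set r root)
      where
      open ≡-Reasoning
      r : Fin n
      r = proj₁ inner-vertex
      not-exponent-2 : ¬ (∀ x → x ∙ x ≡ ε)
      not-exponent-2 squares =
        let q , k≡ = PrimeExponent.order-prime-power prime[2] (λ x → trans (cong (x ∙_) (identityʳ x)) (squares x))
        in not-power q k≡
      open NotExponentTwo not-exponent-2
      size : ∀ {v m} → deg T v ≢ 1 → 3 + m ≡ k → m ≡ deg T v
      size {v} {m} inner-v e = ℕ.+-cancelˡ-≡ 3 _ _ (begin
        3 + m          ≡⟨ e ⟩
        k              ≡⟨ Δ+3≡k ⟨
        Δ T + 3        ≡⟨ cong (_+ 3) (regular v inner-v) ⟨
        deg T v + 3    ≡⟨ ℕ.+-comm (deg T v) 3 ⟩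
        3 + deg T v    ∎)
      root : RootSet (deg T r)
      root = let S , len , rest = co-root-set 8<k in S , size (proj₂ inner-vertex) len , rest
      zero-sums : ∀ v → 3 ≤ deg T v → ∀ {a} → a ≢ ε → ZeroSumSet (deg T v ∸ 1) a
      zero-sums v 3≤deg a≢ε =
        let B , len , rest = co-zero-sum 8<k a≢ε
        in B , cong (_∸ 1) (size (λ leaf → ℕ.<-irrefl (sym leaf) (ℕ.<⇒≤ 3≤deg)) len) , rest

-- Arithmetic of the orders

3^p-mod-8 : ∀ p → ∃ λ j → 3 ^ p ≡ 1 + j * 8 ⊎ 3 ^ p ≡ 3 + j * 8
3^p-mod-8 zero    = 0 , inj₁ refl
3^p-mod-8 (suc p) with 3^p-mod-8 p
... | j , inj₁ e = j * 3 , inj₂ (trans (cong (3 *_) e) (lemma j))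
  where
  lemma : ∀ j → 3 * (1 + j * 8) ≡ 3 + j * 3 * 8
  lemma = solve-∀
... | j , inj₂ e = 1 + j * 3 , inj₁ (trans (cong (3 *_) e) (lemma j))
  where
  lemma : ∀ j → 3 * (3 + j * 8) ≡ 1 + (1 + j * 3) * 8
  lemma = solve-∀

2^q-mod-8 : ∀ s j q → s + j * 8 ≡ 2 ^ (3 + q) → s % 8 ≡ 0
2^q-mod-8 s j q eq = begin
  s % 8               ≡⟨ [m+kn]%n≡m%n s j 8 ⟨
  (s + j * 8) % 8     ≡⟨ cong (_% 8) (trans eq (lemma (2 ^ q))) ⟩
  (2 ^ q * 8) % 8     ≡⟨ m*n%n≡0 (2 ^ q) 8 ⟩
  0                   ∎
  where
  open ≡-Reasoning
  lemma : ∀ t → 2 * (2 * (2 * t)) ≡ t * 8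
  lemma = solve-∀

-- The bound forces `2 ^ q` to be divisible by `8`, but `1 + 3 ^ p` is `2` or `4` modulo `8`.
1+3^p≢2^q : ∀ p q → 8 < 1 + 3 ^ p → 1 + 3 ^ p ≢ 2 ^ q
1+3^p≢2^q p 0 8< e = contradiction (subst (8 <_) e 8<) (ℕ.≤⇒≯ (ℕ.m≤m+n 1 7))
1+3^p≢2^q p 1 8< e = contradiction (subst (8 <_) e 8<) (ℕ.≤⇒≯ (ℕ.m≤m+n 2 6))
1+3^p≢2^q p 2 8< e = contradiction (subst (8 <_) e 8<) (ℕ.≤⇒≯ (ℕ.m≤m+n 4 4))
1+3^p≢2^q p (suc (suc (suc q))) _ e with 3^p-mod-8 p
... | j , inj₁ e′ = contradiction (2^q-mod-8 2 j q (trans (cong suc (sym e′)) e)) (λ ())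
... | j , inj₂ e′ = contradiction (2^q-mod-8 4 j q (trans (cong suc (sym e′)) e)) (λ ())

-- Assembling the two bounds

theorem4 : {c ℓ : Level} (n : ℕ) (T : SimpleGraph n) → IsTree T → 3 ≤ n →
    let Case1 = (Δ T % 2 ≡ 1) × ¬ (Σ ℕ λ p → (2 ≤ p) × IsRegularTree T (3 ^ p ∸ 2))
    in (Case1 → GroupTwinIndex≤ c ℓ T (Δ T + 2))
    × (¬ Case1 → GroupTwinIndex≤ c ℓ T (Δ T + 3))
theorem4 {c} {ℓ} n T (conn , acyclic) 3≤n = case1 , case2
  where
  open Trees T conn acyclic (λ r → Graph.BFS.rooted T r conn) 3≤n

  Case1 : Set
  Case1 = (Δ T % 2 ≡ 1) × ¬ (Σ ℕ λ p → (2 ≤ p) × IsRegularTree T (3 ^ p ∸ 2))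

  case1 : Case1 → GroupTwinIndex≤ c ℓ T (Δ T + 2)
  case1 (odd , not-special) = Δ T + 2 , ℕ.m≤n+m 2 (Δ T) , ℕ.≤-refl , λ A order → Transport.transport-colouring A order T (colouring (Transport.finGroup A order))
    where
    odd-order : (Δ T + 2) % 2 ≡ 1
    odd-order = trans ([m+kn]%n≡m%n (Δ T) 1 2) odd
    not-power : IsRegularTree T (Δ T) → ∀ p → Δ T + 2 ≢ 3 ^ p
    -- As `Δ T + 2` is at least `4`, the powers `1` and `3` are impossible; higher powers are
    -- excluded by `not-special`.
    not-power regular 0 e = contradiction (subst (4 ≤_) e (ℕ.+-monoˡ-≤ 2 Δ≥2)) (ℕ.<⇒≱ (ℕ.m≤m+n 2 2))
    not-power regular 1 e = contradiction (subst (4 ≤_) e (ℕ.+-monoˡ-≤ 2 Δ≥2)) (ℕ.<⇒≱ (ℕ.m≤m+n 4 0))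
    not-power regular p@(suc (suc _)) e =
      not-special (p , s≤s (s≤s z≤n) , subst (IsRegularTree T) (trans (sym (ℕ.m+n∸n≡m (Δ T) 2)) (cong (_∸ 2) e)) regular)
    colouring : (𝔾 : FinGroup (Δ T + 2)) → HasTwinColoring (FinGroup.abelianGroup 𝔾) T
    colouring 𝔾 = [ regular-colouring , irregular-colouring ]′ (toSum regular?)
      where
      3<Δ+2 : 3 < Δ T + 2
      3<Δ+2 = ℕ.+-monoˡ-≤ 2 Δ≥2
      regular-colouring : IsRegularTree T (Δ T) → HasTwinColoring (FinGroup.abelianGroup 𝔾) T
      regular-colouring regular = colouring-regular-odd 𝔾 3<Δ+2 odd-order refl regular (not-power regular)
      irregular-colouring : ¬ IsRegularTree T (Δ T) → HasTwinColoring (FinGroup.abelianGroup 𝔾) T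
      irregular-colouring ¬regular =
        let r , inner , deg<Δ = irregular-vertex ¬regular in
        colouring-odd 𝔾 3<Δ+2 odd-order ℕ.≤-refl r inner
          (subst (_≤ Δ T + 2) (sym (ℕ.+-suc (deg T r) 2)) (ℕ.+-monoˡ-≤ 2 deg<Δ))

  case2 : ¬ Case1 → GroupTwinIndex≤ c ℓ T (Δ T + 3)
  case2 not-case1 = Δ T + 3 , ℕ.≤-trans (ℕ.m≤m+n 2 1) (ℕ.m≤n+m 3 (Δ T)) , ℕ.≤-refl , λ A order → Transport.transport-colouring A order T (colouring (Transport.finGroup A order))
    where
    3<Δ+3 : 3 < Δ T + 3
    3<Δ+3 = ℕ.+-monoˡ-≤ 3 (ℕ.<⇒≤ Δ≥2)
    special-order : ∀ {p} → 2 ≤ p → IsRegularTree T (3 ^ p ∸ 2) → Δ T + 3 ≡ 1 + 3 ^ p × 8 < Δ T + 3 × IsRegularTree T (Δ T)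
    special-order {p} 2≤p regular = eq , subst (8 <_) (sym eq) (s≤s (ℕ.≤-trans (ℕ.m≤m+n 8 1) 9≤3^p)) , subst (IsRegularTree T) (regular-degree regular) regular
      where
      9≤3^p : 9 ≤ 3 ^ p
      9≤3^p = ℕ.^-monoʳ-≤ 3 2≤p
      eq : Δ T + 3 ≡ 1 + 3 ^ p
      eq = trans (ℕ.+-suc (Δ T) 2) (cong suc (trans (cong (_+ 2) (sym (regular-degree regular))) (ℕ.m∸n+n≡m (ℕ.≤-trans (ℕ.m≤m+n 2 7) 9≤3^p))))
    colouring : (𝔾 : FinGroup (Δ T + 3)) → HasTwinColoring (FinGroup.abelianGroup 𝔾) T
    colouring 𝔾 = [ odd-colouring , even-colouring ]′ (toSum (Δ T % 2 ℕ.≟ 1))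
      where
      -- The order is odd and large enough for any inner vertex to be the root.
      even-colouring : Δ T % 2 ≢ 1 → HasTwinColoring (FinGroup.abelianGroup 𝔾) T
      even-colouring not-odd =
        colouring-odd 𝔾 3<Δ+3 odd-order (ℕ.+-monoʳ-≤ (Δ T) (ℕ.m≤m+n 2 1)) _ (proj₂ inner-vertex) (ℕ.+-monoˡ-≤ 3 (deg≤Δ _))
        where
        even : Δ T % 2 ≡ 0
        even = ℕ.n≤0⇒n≡0 (ℕ.≤-pred (ℕ.≤∧≢⇒< (ℕ.≤-pred (m%n<n (Δ T) 2)) not-odd))
        odd-order : (Δ T + 3) % 2 ≡ 1
        odd-order = trans (%-distribˡ-+ (Δ T) 3 2) (cong (λ d → (d + 1) % 2) even)
      -- Failure of `Case1` yields the exceptional regularity only up to double negation. That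
      -- suffices, as the size bound and regularity are decidable and the remaining goal is a
      -- negation.
      odd-colouring : Δ T % 2 ≡ 1 → HasTwinColoring (FinGroup.abelianGroup 𝔾) T
      odd-colouring odd = colouring-regular 𝔾 3<Δ+3
        (decidable-stable (8 ℕ.<? Δ T + 3) (λ ¬large → ¬¬special (λ (_ , 2≤p , reg) → ¬large (proj₁ (proj₂ (special-order 2≤p reg))))))
        refl
        (decidable-stable regular? (λ ¬regular → ¬¬special (λ (_ , 2≤p , reg) → ¬regular (proj₂ (proj₂ (special-order 2≤p reg))))))
        (λ q e → ¬¬special (λ (p , 2≤p , reg) →
          let (eq , 8< , _) = special-order 2≤p reg in 1+3^p≢2^q p q (subst (8 <_) eq 8<) (trans (sym eq) e)))
        where
        ¬¬special : ¬ ¬ (Σ ℕ λ p → (2 ≤ p) × IsRegularTree T (3 ^ p ∸ 2))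
        ¬¬special ¬special = not-case1 (odd , ¬special)
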